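{- Let $n>3$ be an integer. Then the line graph $L(Cr(n))$ of the crown graph $Cr(n)$ is distance integral, and its set of distinct distance eigenvalues is $\{ -n-1,\ -n+3,\ -1,\ 1,\ 2n^2-4n+3\}$.
   Context: For a finite connected simple undirected graph $G=(V,E)$, the distance matrix $D(G)$ is the matrix indexed by $V\times V$ with entries $D_{u,v}=d(u,v)$, the graph distance between $u$ and $v$. The distance eigenvalues of $G$ are the eigenvalues of $D(G)$, and $G$ is called distance integral if all of them are integers. The crown graph $Cr(n)$ is the graph obtained from the complete bipartite graph $K_{n,n}$ by removing a perfect matching. Its line graph $L(Cr(n))$ has the edges of $Cr(n)$ as vertices, two being adjacent when they are distinct and share an endpoint; equivalently, $L(Cr(n))$ is (up to isomorphism) the graph with vertex set $\{(i,j) : i,j\in\{1,\dots,n\},\ i\neq j\}$ in which two distinct vertices $(i,j)$ and $(r,s)$ are adjacent if and only if $i=r$ or $j=s$. -}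

module Defs where

open import Algebra.Bundles.Raw using (RawMonoid)
import Algebra.Definitions.RawMonoid as Sum
open import Data.Empty using (⊥)
open import Data.Fin.Base using (Fin; splitAt)
import Data.Fin.Base as Fin
import Data.Fin.Properties as Fin
open import Data.Integer.Base as ℤ using (ℤ; +_)
open import Data.List.Base using (List; allFin; cartesianProduct; filter; length; lookup)
open import Data.Nat.Base as ℕ using (ℕ; suc)
import Data.Nat.Properties as ℕ
open import Data.Product.Base using (Σ-syntax; ∃; ∃-syntax; _×_; _,_)
open import Data.Rational.Base as ℚ using (ℚ; 0ℚ; 1ℚ; ½)
import Data.Rational.Properties as ℚ
import Data.Rational.Solver as ℚ
open import Data.Sum.Base using (_⊎_; inj₁; inj₂)
open import Function.Base using (_∘_)
open import Level using (0ℓ)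
open import Relation.Binary.Definitions using (Decidable; Irreflexive; Symmetric)
open import Relation.Binary.PropositionalEquality using (_≡_; _≢_; refl; sym; trans; cong; subst)
open import Relation.Nullary.Decidable.Core using (Dec; yes; no; ¬?; _×-dec_; _⊎-dec_)

------------------------------------------------------------------------
-- Real numbers: Cauchy sequences of rationals, up to _≈ℝ_

Cauchy : (ℕ → ℚ) → Set
Cauchy x = ∀ ε → 0ℚ ℚ.< ε →
  ∃[ N ] (∀ m n → N ℕ.≤ m → N ℕ.≤ n → ℚ.∣ x m ℚ.- x n ∣ ℚ.< ε)

record ℝ : Set where
  constructor mkℝ
  field
    seq    : ℕ → ℚ
    cauchy : Cauchy seq

open ℝ public

infix 4 _≈ℝ_ _#ℝ_

_≈ℝ_ : ℝ → ℝ → Set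
x ≈ℝ y = ∀ ε → 0ℚ ℚ.< ε →
  ∃[ N ] (∀ n → N ℕ.≤ n → ℚ.∣ seq x n ℚ.- seq y n ∣ ℚ.< ε)

-- Apartness, the constructive form of "x ≠ y" (classically the negation of
-- _≈ℝ_).
_#ℝ_ : ℝ → ℝ → Set
x #ℝ y = ∃[ ε ] 0ℚ ℚ.< ε ×
  (∃[ N ] (∀ n → N ℕ.≤ n → ε ℚ.< ℚ.∣ seq x n ℚ.- seq y n ∣))

module CauchyLemmas where

  ½ε+½ε : ∀ ε → ½ ℚ.* ε ℚ.+ ½ ℚ.* ε ≡ ε
  ½ε+½ε ε = trans (sym (ℚ.*-distribʳ-+ ε ½ ½)) (ℚ.*-identityˡ ε)

  ½-pos : ∀ {ε} → 0ℚ ℚ.< ε → 0ℚ ℚ.< ½ ℚ.* ε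
  ½-pos {ε} 0<ε = subst (ℚ._< ½ ℚ.* ε) (ℚ.*-zeroʳ ½) (ℚ.*-monoʳ-<-pos ½ 0<ε)

  -- |(a + b) - (c + d)| and |a b - c d| are estimated from |a - c| and |b - d|.
  +-rearrange : ∀ a b c d →
    (a ℚ.+ b) ℚ.- (c ℚ.+ d) ≡ (a ℚ.- c) ℚ.+ (b ℚ.- d)
  +-rearrange = solve 4 (λ a b c d →
    (a :+ b) :- (c :+ d) := (a :- c) :+ (b :- d)) refl
    where open ℚ.+-*-Solver

  *-rearrange : ∀ a b c d →
    (a ℚ.* b) ℚ.- (c ℚ.* d) ≡ a ℚ.* (b ℚ.- d) ℚ.+ d ℚ.* (a ℚ.- c)
  *-rearrange = solve 4 (λ a b c d →
    (a :* b) :- (c :* d) := a :* (b :- d) :+ d :* (a :- c)) refl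
    where open ℚ.+-*-Solver

  neg-rearrange : ∀ a c → (ℚ.- a) ℚ.- (ℚ.- c) ≡ ℚ.- (a ℚ.- c)
  neg-rearrange = solve 2 (λ a c → (:- a) :- (:- c) := :- (a :- c)) refl
    where open ℚ.+-*-Solver

  split : ∀ a c → a ≡ c ℚ.+ (a ℚ.- c)
  split = solve 2 (λ a c → a := c :+ (a :- c)) refl
    where open ℚ.+-*-Solver

  Bounded : (ℕ → ℚ) → ℚ → ℕ → Set
  Bounded x B N = ∀ n → N ℕ.≤ n → ℚ.∣ x n ∣ ℚ.< B

  eventuallyBounded : ∀ x → Cauchy x → ∃[ B ] 0ℚ ℚ.< B × ∃ (Bounded x B)
  eventuallyBounded x cx with cx 1ℚ (ℚ.positive⁻¹ 1ℚ)
  ... | N , close = ℚ.∣ x N ∣ ℚ.+ 1ℚ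
                  , ℚ.+-mono-≤-< (ℚ.0≤∣p∣ (x N)) (ℚ.positive⁻¹ 1ℚ)
                  , N , bound
    where
    open ℚ.≤-Reasoning
    bound : Bounded x (ℚ.∣ x N ∣ ℚ.+ 1ℚ) N
    bound n N≤n = begin-strict
      ℚ.∣ x n ∣                           ≡⟨ cong ℚ.∣_∣ (split (x n) (x N)) ⟩
      ℚ.∣ x N ℚ.+ (x n ℚ.- x N) ∣         ≤⟨ ℚ.∣p+q∣≤∣p∣+∣q∣ (x N) (x n ℚ.- x N) ⟩
      ℚ.∣ x N ∣ ℚ.+ ℚ.∣ x n ℚ.- x N ∣     <⟨ ℚ.+-monoʳ-< ℚ.∣ x N ∣ (close n N N≤n ℕ.≤-refl) ⟩
      ℚ.∣ x N ∣ ℚ.+ 1ℚ                    ∎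

  -- δ is ε / B.
  product-small : ∀ B → 0ℚ ℚ.< B → ∀ ε → 0ℚ ℚ.< ε →
    ∃[ δ ] 0ℚ ℚ.< δ ×
      (∀ p q → ℚ.∣ p ∣ ℚ.< B → ℚ.∣ q ∣ ℚ.< δ → ℚ.∣ p ℚ.* q ∣ ℚ.< ε)
  product-small B 0<B ε 0<ε = B⁻¹ ℚ.* ε , δ-pos , small
    where
    instance
      B-pos : ℚ.Positive B
      B-pos = ℚ.positive 0<B
      B-nonZero : ℚ.NonZero B
      B-nonZero = ℚ.pos⇒nonZero B
    B⁻¹ : ℚ
    B⁻¹ = ℚ.1/ B
    instance
      B⁻¹-pos : ℚ.Positive B⁻¹
      B⁻¹-pos = ℚ.1/pos⇒pos B
    δ-pos : 0ℚ ℚ.< B⁻¹ ℚ.* ε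
    δ-pos = subst (ℚ._< B⁻¹ ℚ.* ε) (ℚ.*-zeroʳ B⁻¹) (ℚ.*-monoʳ-<-pos B⁻¹ 0<ε)
    open ℚ.≤-Reasoning
    small : ∀ p q → ℚ.∣ p ∣ ℚ.< B → ℚ.∣ q ∣ ℚ.< B⁻¹ ℚ.* ε → ℚ.∣ p ℚ.* q ∣ ℚ.< ε
    small p q p<B q<δ = begin-strict
      ℚ.∣ p ℚ.* q ∣             ≡⟨ ℚ.∣p*q∣≡∣p∣*∣q∣ p q ⟩
      ℚ.∣ p ∣ ℚ.* ℚ.∣ q ∣       ≤⟨ ℚ.*-monoʳ-≤-nonNeg ℚ.∣ q ∣ {{ℚ.∣-∣-nonNeg q}} (ℚ.<⇒≤ p<B) ⟩
      B ℚ.* ℚ.∣ q ∣             <⟨ ℚ.*-monoʳ-<-pos B q<δ ⟩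
      B ℚ.* (B⁻¹ ℚ.* ε)         ≡⟨ sym (ℚ.*-assoc B B⁻¹ ε) ⟩
      (B ℚ.* B⁻¹) ℚ.* ε         ≡⟨ cong (ℚ._* ε) (ℚ.*-inverseʳ B) ⟩
      1ℚ ℚ.* ε                  ≡⟨ ℚ.*-identityˡ ε ⟩
      ε                         ∎

  sum-small : ∀ ε p q → ℚ.∣ p ∣ ℚ.< ½ ℚ.* ε → ℚ.∣ q ∣ ℚ.< ½ ℚ.* ε →
    ℚ.∣ p ℚ.+ q ∣ ℚ.< ε
  sum-small ε p q p< q< = begin-strict
    ℚ.∣ p ℚ.+ q ∣             ≤⟨ ℚ.∣p+q∣≤∣p∣+∣q∣ p q ⟩
    ℚ.∣ p ∣ ℚ.+ ℚ.∣ q ∣       <⟨ ℚ.+-mono-< p< q< ⟩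
    ½ ℚ.* ε ℚ.+ ½ ℚ.* ε       ≡⟨ ½ε+½ε ε ⟩
    ε                         ∎
    where open ℚ.≤-Reasoning

  +-cauchy : ∀ x y → Cauchy x → Cauchy y → Cauchy (λ n → x n ℚ.+ y n)
  +-cauchy x y cx cy ε 0<ε
    with cx (½ ℚ.* ε) (½-pos 0<ε) | cy (½ ℚ.* ε) (½-pos 0<ε)
  ... | N₁ , close₁ | N₂ , close₂ = N₁ ℕ.⊔ N₂ , λ m n N≤m N≤n →
    subst (ℚ._< ε) (cong ℚ.∣_∣ (sym (+-rearrange (x m) (y m) (x n) (y n))))
      (sum-small ε (x m ℚ.- x n) (y m ℚ.- y n)
        (close₁ m n (ℕ.m⊔n≤o⇒m≤o N₁ N₂ N≤m) (ℕ.m⊔n≤o⇒m≤o N₁ N₂ N≤n))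
        (close₂ m n (ℕ.m⊔n≤o⇒n≤o N₁ N₂ N≤m) (ℕ.m⊔n≤o⇒n≤o N₁ N₂ N≤n)))

  neg-cauchy : ∀ x → Cauchy x → Cauchy (λ n → ℚ.- x n)
  neg-cauchy x cx ε 0<ε with cx ε 0<ε
  ... | N , close = N , λ m n N≤m N≤n →
    subst (ℚ._< ε)
      (sym (trans (cong ℚ.∣_∣ (neg-rearrange (x m) (x n))) (ℚ.∣-p∣≡∣p∣ (x m ℚ.- x n))))
      (close m n N≤m N≤n)

  *-cauchy : ∀ x y → Cauchy x → Cauchy y → Cauchy (λ n → x n ℚ.* y n)
  *-cauchy x y cx cy ε 0<ε =
    let Bx , 0<Bx , M₁ , bound₁ = eventuallyBounded x cx
        By , 0<By , M₂ , bound₂ = eventuallyBounded y cy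
        δ₁ , 0<δ₁ , small₁ = product-small Bx 0<Bx (½ ℚ.* ε) (½-pos 0<ε)
        δ₂ , 0<δ₂ , small₂ = product-small By 0<By (½ ℚ.* ε) (½-pos 0<ε)
        N₁ , close₁ = cy δ₁ 0<δ₁
        N₂ , close₂ = cx δ₂ 0<δ₂
    in (M₁ ℕ.⊔ M₂) ℕ.⊔ (N₁ ℕ.⊔ N₂) , λ m n N≤m N≤n →
      let Ms≤m = ℕ.m⊔n≤o⇒m≤o (M₁ ℕ.⊔ M₂) (N₁ ℕ.⊔ N₂) N≤m
          Ns≤m = ℕ.m⊔n≤o⇒n≤o (M₁ ℕ.⊔ M₂) (N₁ ℕ.⊔ N₂) N≤m
          Ms≤n = ℕ.m⊔n≤o⇒m≤o (M₁ ℕ.⊔ M₂) (N₁ ℕ.⊔ N₂) N≤n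
          Ns≤n = ℕ.m⊔n≤o⇒n≤o (M₁ ℕ.⊔ M₂) (N₁ ℕ.⊔ N₂) N≤n
      in subst (ℚ._< ε) (cong ℚ.∣_∣ (sym (*-rearrange (x m) (y m) (x n) (y n))))
        (sum-small ε (x m ℚ.* (y m ℚ.- y n)) (y n ℚ.* (x m ℚ.- x n))
          (small₁ (x m) (y m ℚ.- y n)
            (bound₁ m (ℕ.m⊔n≤o⇒m≤o M₁ M₂ Ms≤m))
            (close₁ m n (ℕ.m⊔n≤o⇒m≤o N₁ N₂ Ns≤m) (ℕ.m⊔n≤o⇒m≤o N₁ N₂ Ns≤n)))
          (small₂ (y n) (x m ℚ.- x n)
            (bound₂ n (ℕ.m⊔n≤o⇒n≤o M₁ M₂ Ms≤n))
            (close₂ m n (ℕ.m⊔n≤o⇒n≤o N₁ N₂ Ns≤m) (ℕ.m⊔n≤o⇒n≤o N₁ N₂ Ns≤n))))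

  constant-cauchy : ∀ q → Cauchy (λ _ → q)
  constant-cauchy q ε 0<ε = 0 , λ _ _ _ _ →
    subst (ℚ._< ε) (sym (cong ℚ.∣_∣ (ℚ.+-inverseʳ q))) 0<ε

open CauchyLemmas

infixl 6 _+ℝ_ _-ℝ_
infixl 7 _*ℝ_

_+ℝ_ _-ℝ_ _*ℝ_ : ℝ → ℝ → ℝ
mkℝ x cx +ℝ mkℝ y cy = mkℝ (λ n → x n ℚ.+ y n) (+-cauchy x y cx cy)
mkℝ x cx -ℝ mkℝ y cy = mkℝ (λ n → x n ℚ.- y n) (+-cauchy x (λ n → ℚ.- y n) cx (neg-cauchy y cy))
mkℝ x cx *ℝ mkℝ y cy = mkℝ (λ n → x n ℚ.* y n) (*-cauchy x y cx cy)

fromℚ : ℚ → ℝ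
fromℚ q = mkℝ (λ _ → q) (constant-cauchy q)

0ℝ : ℝ
0ℝ = fromℚ 0ℚ

------------------------------------------------------------------------
-- Complex numbers

infix 4 _≈ℂ_ _#ℂ_
infixl 6 _+ℂ_
infixl 7 _*ℂ_
infix 5 _+i_

record ℂ : Set where
  constructor _+i_
  field
    re im : ℝ

open ℂ public

_≈ℂ_ _#ℂ_ : ℂ → ℂ → Set
z ≈ℂ w = re z ≈ℝ re w × im z ≈ℝ im w
z #ℂ w = re z #ℝ re w ⊎ im z #ℝ im w

_+ℂ_ _*ℂ_ : ℂ → ℂ → ℂ
(a +i b) +ℂ (c +i d) = (a +ℝ c) +i (b +ℝ d)
(a +i b) *ℂ (c +i d) = (a *ℝ c -ℝ b *ℝ d) +i (a *ℝ d +ℝ b *ℝ c)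

fromℤ : ℤ → ℂ
fromℤ m = fromℚ (m ℚ./ 1) +i 0ℝ

0ℂ : ℂ
0ℂ = fromℤ (+ 0)

ℂ-+-rawMonoid : RawMonoid 0ℓ 0ℓ
ℂ-+-rawMonoid = record { Carrier = ℂ ; _≈_ = _≈ℂ_ ; _∙_ = _+ℂ_ ; ε = 0ℂ }

open Sum ℂ-+-rawMonoid using () renaming (sum to sumℂ) public

------------------------------------------------------------------------
-- Matrices and eigenvalues

Matrix : Set → ℕ → Set
Matrix A k = Fin k → Fin k → A

-- "v ≠ 0" is read as: some entry is apart from 0.
IsEigenvalue : ∀ {k} → Matrix ℂ k → ℂ → Set
IsEigenvalue {k} M z = Σ[ v ∈ (Fin k → ℂ) ]
  (∃[ i ] v i #ℂ 0ℂ) × (∀ i → sumℂ (λ j → M i j *ℂ v j) ≈ℂ z *ℂ v i)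

------------------------------------------------------------------------
-- Finite simple graphs

record Graph (k : ℕ) : Set₁ where
  field
    Adj    : Fin k → Fin k → Set
    adj?   : Decidable Adj
    symm   : Symmetric Adj
    irrefl : Irreflexive _≡_ Adj

open Graph public

data Walk {k} (G : Graph k) : Fin k → Fin k → ℕ → Set where
  []  : ∀ {u} → Walk G u u 0
  _∷_ : ∀ {u v w l} → Adj G u v → Walk G v w l → Walk G u w (suc l)

Connected : ∀ {k} → Graph k → Set
Connected G = ∀ u v → ∃ (Walk G u v)

IsDistance : ∀ {k} (G : Graph k) → Fin k → Fin k → ℕ → Set
IsDistance G u v d = Walk G u v d × (∀ l → Walk G u v l → d ℕ.≤ l)

-- Uniquely determines D; such a D exists exactly when G is connected.
IsDistanceMatrix : ∀ {k} → Graph k → Matrix ℕ k → Set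
IsDistanceMatrix G D = ∀ u v → IsDistance G u v (D u v)

IsDistanceEigenvalue : ∀ {k} → Graph k → ℂ → Set
IsDistanceEigenvalue {k} G z = Σ[ D ∈ Matrix ℕ k ]
  IsDistanceMatrix G D × IsEigenvalue (λ u v → fromℤ (+ D u v)) z

DistanceIntegral : ∀ {k} → Graph k → Set
DistanceIntegral G =
  Connected G × (∀ z → IsDistanceEigenvalue G z → ∃[ m ] z ≈ℂ fromℤ m)

------------------------------------------------------------------------
-- Line graphs

-- The edge {u , v} is represented by the pair (u , v) with u < v.
IsEdge : ∀ {k} → Graph k → Fin k × Fin k → Set
IsEdge G (u , v) = u Fin.< v × Adj G u v

isEdge? : ∀ {k} (G : Graph k) (e : Fin k × Fin k) → Dec (IsEdge G e)
isEdge? G (u , v) = (u Fin.<? v) ×-dec adj? G u v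

-- Each edge occurs exactly once.
edges : ∀ {k} → Graph k → List (Fin k × Fin k)
edges {k} G = filter (isEdge? G) (cartesianProduct (allFin k) (allFin k))

_∈ₑ_ : ∀ {k} → Fin k → Fin k × Fin k → Set
w ∈ₑ (u , v) = w ≡ u ⊎ w ≡ v

ShareEndpoint : ∀ {k} → Fin k × Fin k → Fin k × Fin k → Set
ShareEndpoint e f = ∃[ w ] w ∈ₑ e × w ∈ₑ f

private
  _∈ₑ?_ : ∀ {k} → Decidable (_∈ₑ_ {k})
  w ∈ₑ? (u , v) = (w Fin.≟ u) ⊎-dec (w Fin.≟ v)

-- Vertex a of the line graph is the edge at position a of the list of edges.
lineGraph : ∀ {k} (G : Graph k) → Graph (length (edges G))
lineGraph G = record
  { Adj    = λ a b → a ≢ b × ShareEndpoint (edge a) (edge b)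
  ; adj?   = λ a b → ¬? (a Fin.≟ b) ×-dec
                     Fin.any? (λ w → (w ∈ₑ? edge a) ×-dec (w ∈ₑ? edge b))
  ; symm   = λ (a≢b , w , w∈a , w∈b) → (a≢b ∘ sym) , w , w∈b , w∈a
  ; irrefl = λ a≡b (a≢b , _) → a≢b a≡b
  }
  where edge = lookup (edges G)

------------------------------------------------------------------------
-- Crown graphs

-- inj₁ and inj₂ are the two sides of K_{n,n}; the perfect matching that is
-- removed consists of the edges joining inj₁ i to inj₂ i.
CrownAdj : ∀ {n} → Fin n ⊎ Fin n → Fin n ⊎ Fin n → Set
CrownAdj (inj₁ i) (inj₂ j) = i ≢ j
CrownAdj (inj₂ i) (inj₁ j) = i ≢ j
CrownAdj (inj₁ _) (inj₁ _) = ⊥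
CrownAdj (inj₂ _) (inj₂ _) = ⊥

private
  crownAdj? : ∀ {n} → Decidable (CrownAdj {n})
  crownAdj? (inj₁ i) (inj₂ j) = ¬? (i Fin.≟ j)
  crownAdj? (inj₂ i) (inj₁ j) = ¬? (i Fin.≟ j)
  crownAdj? (inj₁ _) (inj₁ _) = no λ ()
  crownAdj? (inj₂ _) (inj₂ _) = no λ ()

  crownAdj-sym : ∀ {n} (u v : Fin n ⊎ Fin n) → CrownAdj u v → CrownAdj v u
  crownAdj-sym (inj₁ _) (inj₂ _) i≢j = i≢j ∘ sym
  crownAdj-sym (inj₂ _) (inj₁ _) i≢j = i≢j ∘ sym

  crownAdj-irrefl : ∀ {n} (u : Fin n ⊎ Fin n) → CrownAdj u u → ⊥
  crownAdj-irrefl (inj₁ _) ()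
  crownAdj-irrefl (inj₂ _) ()

crown : ∀ n → Graph (n ℕ.+ n)
crown n = record
  { Adj    = λ u v → CrownAdj (splitAt n u) (splitAt n v)
  ; adj?   = λ u v → crownAdj? (splitAt n u) (splitAt n v)
  ; symm   = λ {u} {v} → crownAdj-sym (splitAt n u) (splitAt n v)
  ; irrefl = λ { {u} refl → crownAdj-irrefl (splitAt n u) }
  }

{-# OPTIONS --safe #-}

-- On the pairs (i , j) with i ≠ j the distance is
--   2 − [i = r] − [j = s] + [i = s][j = r],
-- so the distance matrix sends an array w with zero diagonal to
-- 2S − Rᵢ − Cⱼ + w(j , i), where S, R, C are its total, row and column sums.
-- If z w is this image, summing over rows and columns gives
-- z S = (2n² − 4n + 3) S, and, once S = 0,
-- z (R ± C) = (−n + 1 ± 2)(R ± C); once R = C = 0, z (w ± wᵀ) = ± (w ± wᵀ).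
-- Hence w = 0 if z is apart from all five values.  The constructive passage
-- from this to "z equals one of them" uses that distinct integers are at
-- distance at least 1, so that z is near at most one integer, and that
-- apartness of Cauchy reals is tight.
-- Conversely, eigenvectors are 1, pᵢ ± pⱼ and pᵢ qⱼ ± qᵢ pⱼ, where
-- p = e₀ − e₂ and q = e₁ − e₃.

module Submission where

open import Defs
open CauchyLemmas
open import Algebra.Bundles using (CommutativeRing)
import Algebra.Solver.Ring
open import Algebra.Solver.Ring.AlmostCommutativeRing using (_-Raw-AlmostCommutative⟶_; fromCommutativeRing)
open import Data.Bool.Base using (if_then_else_)
open import Data.Fin.Base as Fin using (Fin; zero; suc; punchIn; punchOut; splitAt; _↑ˡ_; _↑ʳ_)
import Data.Fin.Properties as Fin
open import Data.Integer.Base as ℤ using (ℤ; +_; -_; 0ℤ; 1ℤ; -1ℤ)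
import Data.Integer.Properties as ℤ
open import Data.List.Base using (List; []; _∷_; lookup; length; allFin; cartesianProduct)
open import Data.List.Membership.Propositional using (_∈_)
import Data.List.Membership.Propositional.Properties as List
import Data.List.Relation.Unary.All as All
open import Data.List.Relation.Unary.AllPairs using (_∷_)
open import Data.List.Relation.Unary.Any as Any using (here; there)
open import Data.List.Relation.Unary.Any.Properties using (lookup-index)
open import Data.List.Relation.Unary.Unique.Propositional using (Unique)
import Data.List.Relation.Unary.Unique.Propositional.Properties as Unique
open import Data.Maybe.Base as Maybe using (Maybe)
open import Data.Nat.Base as ℕ using (ℕ; zero; suc; _<_; z≤n; s≤s)
import Data.Nat.Properties as ℕ
open import Data.Product.Base using (∃-syntax; ∃₂; _×_; _,_; proj₁; proj₂; map₂)
open import Data.Product.Properties using (,-injective)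
open import Data.Rational.Base as ℚ using (ℚ; 0ℚ; 1ℚ; ½)
import Data.Rational.Properties as ℚ
import Data.Rational.Solver as ℚ
open import Data.Rational.Unnormalised.Base as ℚᵘ using (mkℚᵘ; *≤*)
import Data.Rational.Unnormalised.Properties as ℚᵘ
open import Data.Sum.Base as Sum using (_⊎_; inj₁; inj₂; [_,_]′)
open import Function.Base using (_∘_; id)
open import Function.Bundles using (_⇔_; mk⇔)
open import Level using (_⊔_; 0ℓ)
open import Relation.Binary.PropositionalEquality as ≡ using (_≡_; _≢_)
open import Relation.Nullary.Decidable.Core using (Dec; yes; no; does; dec⇒maybe)
open import Relation.Nullary.Negation.Core using (¬_; contradiction)

-- The elimination uses no division: it needs only that 2 and the differences z - m are
-- non-zero-divisors. It is therefore carried out over an arbitrary commutative ring with a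
-- homomorphism from ℤ, where identities go to a ring solver with integer coefficients; ℂ enters
-- afterwards, and its non-zero-divisors come from apartness. The term [i = s][j = r] records
-- missing vertices. If (i , j) and (r , s) share no coordinate, their only possible common
-- neighbours are the corners (i , s) and (r , j); both corners lie on the deleted diagonal exactly
-- when (r , s) = (j , i), and then the distance is 3. The bound n > 3 enters twice: the detour
-- between swapped pairs needs a third index, and p and q need disjoint supports of two indices
-- each. The five values can coincide, since -n + 3 = -1 for n = 4; hence the final selection
-- compares values and not places in the list.

-- Off-diagonal pairs and the distance formula

spectrum : ℕ → List ℤ
spectrum n =
  (- + n ℤ.- + 1) ∷ (- + n ℤ.+ + 3) ∷ -1ℤ ∷ 1ℤ ∷
  (+ 2 ℤ.* (+ n ℤ.* + n) ℤ.- + 4 ℤ.* + n ℤ.+ + 3) ∷ []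

δ : ∀ {n} → Fin n → Fin n → ℤ
δ i j = if does (i Fin.≟ j) then 1ℤ else 0ℤ

δ-refl : ∀ {n} (i : Fin n) → δ i i ≡ 1ℤ
δ-refl i with i Fin.≟ i
... | yes _  = ≡.refl
... | no i≢i = contradiction ≡.refl i≢i

δ-≢ : ∀ {n} {i j : Fin n} → i ≢ j → δ i j ≡ 0ℤ
δ-≢ {i = i} {j} i≢j with i Fin.≟ j
... | yes i≡j = contradiction i≡j i≢j
... | no _    = ≡.refl

δ-≡ : ∀ {n} {i j : Fin n} → i ≡ j → δ i j ≡ 1ℤ
δ-≡ {i = i} ≡.refl = δ-refl i

δ-sym : ∀ {n} (i j : Fin n) → δ i j ≡ δ j i
δ-sym i j with i Fin.≟ j
... | yes ≡.refl = ≡.sym (δ-refl i)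
... | no i≢j     = ≡.sym (δ-≢ (λ j≡i → i≢j (≡.sym j≡i)))

-- A numbering of the pairs (i , j) with i ≠ j by `Fin k`. Keeping it abstract separates the linear
-- algebra from the way in which the edge list happens to enumerate the vertices.
record OffDiagonal (n k : ℕ) : Set where
  field
    row col   : Fin k → Fin n
    row≢col   : ∀ a → row a ≢ col a
    injective : ∀ {a b} → row a ≡ row b → col a ≡ col b → a ≡ b
    index     : ∀ {i j} → i ≢ j → ∃[ a ] row a ≡ i × col a ≡ j

  Aligned : Fin k → Fin k → Set
  Aligned a b = row a ≡ row b ⊎ col a ≡ col b

  distanceℤ : Fin k → Fin k → ℤ
  distanceℤ a b = + 2 ℤ.- δ (row a) (row b) ℤ.- δ (col a) (col b)
                  ℤ.+ δ (row a) (col b) ℤ.* δ (col a) (row b)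

-- The distance operator over a commutative ring

module Spectrum {a ℓ} (R : CommutativeRing a ℓ)
  (morphism : ℤ.+-*-rawRing -Raw-AlmostCommutative⟶ fromCommutativeRing R)
  where

  open CommutativeRing R renaming (-_ to -ᴿ_; zero to *-zero)
  open _-Raw-AlmostCommutative⟶_ morphism renaming (⟦_⟧ to ι)
  open import Algebra.Properties.Semiring.Sum semiring
  open import Relation.Binary.Reasoning.Setoid setoid

  -- Equality in the ring is not decidable, so the solver compares coefficients as integers.
  ι-≈? : ∀ m n → Maybe (ι m ≈ ι n)
  ι-≈? m n = Maybe.map (λ m≡n → reflexive (≡.cong ι m≡n)) (dec⇒maybe (m ℤ.≟ n))

  open Algebra.Solver.Ring ℤ.+-*-rawRing (fromCommutativeRing R) morphism ι-≈?
    using (solve; con; _:+_; _:-_; _:*_; :-_; _:=_)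

  ι-δ-refl : ∀ {n} (i : Fin n) → ι (δ i i) ≈ 1#
  ι-δ-refl i = trans (reflexive (≡.cong ι (δ-refl i))) 1-homo

  ι-δ-≢ : ∀ {n} {i j : Fin n} → i ≢ j → ι (δ i j) ≈ 0#
  ι-δ-≢ i≢j = trans (reflexive (≡.cong ι (δ-≢ i≢j))) 0-homo

  sum-≈0 : ∀ {n} {f : Fin n → Carrier} → (∀ i → f i ≈ 0#) → sum f ≈ 0#
  sum-≈0 {n} f≈0 = trans (sum-cong-≋ f≈0) (sum-replicate-zero n)

  sum-single : ∀ {n} (i : Fin n) (f : Fin n → Carrier) →
    (∀ j → j ≢ i → f j ≈ 0#) → sum f ≈ f i
  sum-single {suc n} i f f≈0 = begin
    sum f                                ≈⟨ sum-remove {i = i} f ⟩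
    f i + sum (λ j → f (punchIn i j))    ≈⟨ +-congˡ (sum-≈0 (λ j → f≈0 _ (Fin.punchInᵢ≢i i j))) ⟩
    f i + 0#                             ≈⟨ +-identityʳ _ ⟩
    f i                                  ∎

  sum-δ : ∀ {n} (i : Fin n) (f : Fin n → Carrier) → sum (λ j → ι (δ i j) * f j) ≈ f i
  sum-δ i f = trans
    (sum-single i _ (λ j j≢i → trans (*-congʳ (ι-δ-≢ (λ i≡j → j≢i (≡.sym i≡j)))) (zeroˡ _)))
    (trans (*-congʳ (ι-δ-refl i)) (*-identityˡ _))

  -- Both sides are the common sum away from `i` plus `f i + g i`. This form serves equations that
  -- are known only off the diagonal.
  sum-agreeOff : ∀ {n} (i : Fin n) (f g : Fin n → Carrier) →
    (∀ j → j ≢ i → f j ≈ g j) → sum f + g i ≈ sum g + f i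
  sum-agreeOff {suc n} i f g f≈g = begin
    sum f + g i                                   ≈⟨ +-congʳ (sum-remove {i = i} f) ⟩
    f i + sum (λ j → f (punchIn i j)) + g i       ≈⟨ +-congʳ (+-congˡ (sum-cong-≋ (λ j → f≈g _ (Fin.punchInᵢ≢i i j)))) ⟩
    f i + sum (λ j → g (punchIn i j)) + g i       ≈⟨ solve 3 (λ x s y → x :+ s :+ y := y :+ s :+ x) refl (f i) _ (g i) ⟩
    g i + sum (λ j → g (punchIn i j)) + f i       ≈⟨ +-congʳ (sum-remove {i = i} g) ⟨
    sum g + f i                                   ∎

  sum-const : ∀ n x → sum {n} (λ _ → x) ≈ ι (+ n) * x
  sum-const zero    x = sym (trans (*-congʳ 0-homo) (zeroˡ x))
  sum-const (suc n) x = begin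
    x + sum {n} (λ _ → x)    ≈⟨ +-congˡ (sum-const n x) ⟩
    x + ι (+ n) * x          ≈⟨ solve 2 (λ x y → x :+ y :* x := (con 1ℤ :+ y) :* x) refl x (ι (+ n)) ⟩
    (ι 1ℤ + ι (+ n)) * x     ≈⟨ *-congʳ (+-homo 1ℤ (+ n)) ⟨
    ι (+ suc n) * x          ∎

  sum-distrib-- : ∀ {n} (f g : Fin n → Carrier) → sum (λ i → f i - g i) ≈ sum f - sum g
  sum-distrib-- {zero}  f g = sym (-‿inverseʳ 0#)
  sum-distrib-- {suc n} f g = begin
    f zero - g zero + sum (λ i → f (suc i) - g (suc i))
      ≈⟨ +-congˡ (sum-distrib-- (λ i → f (suc i)) (λ i → g (suc i))) ⟩
    f zero - g zero + (sum (λ i → f (suc i)) - sum (λ i → g (suc i)))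
      ≈⟨ solve 4 (λ a b c d → (a :- b) :+ (c :- d) := (a :+ c) :- (b :+ d)) refl _ _ _ _ ⟩
    f zero + sum (λ i → f (suc i)) - (g zero + sum (λ i → g (suc i)))
      ∎

  -- Arrays with zero diagonal and the eigenvalue equation

  Array : ℕ → Set a
  Array n = Fin n → Fin n → Carrier

  transpose : ∀ {n} → Array n → Array n
  transpose w i j = w j i

  rowSum colSum : ∀ {n} → Array n → Fin n → Carrier
  rowSum w i = sum (w i)
  colSum w j = rowSum (transpose w) j

  total : ∀ {n} → Array n → Carrier
  total w = sum (rowSum w)

  ZeroDiagonal : ∀ {n} → Array n → Set ℓ
  ZeroDiagonal w = ∀ i → w i i ≈ 0#

  -- The action of the distance matrix on an array w with zero diagonal,
  -- meaningful off the diagonal only.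
  distanceOperator : ∀ {n} → Array n → Array n
  distanceOperator w i j = ι (+ 2) * total w - rowSum w i - colSum w j + w j i

  -- The equation is imposed off the diagonal only, because diagonal positions are not vertices;
  -- there the operator may take any value.
  Eigenarray : ∀ {n} → Carrier → Array n → Set ℓ
  Eigenarray z w = ZeroDiagonal w × (∀ i j → i ≢ j → distanceOperator w i j ≈ z * w i j)

  -- Swapping the coordinates is an automorphism of the graph. Through it every identity for row
  -- sums yields one for column sums.
  transpose-eigenarray : ∀ {n z} {w : Array n} → Eigenarray z w → Eigenarray z (transpose w)
  transpose-eigenarray {w = w} (diag , eigen) = diag , λ i j i≢j → begin
    ι (+ 2) * total (transpose w) - colSum w i - rowSum w j + w i j
      ≈⟨ +-congʳ (+-congʳ (+-congʳ (*-congˡ (∑-comm (transpose w))))) ⟩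
    ι (+ 2) * total w - colSum w i - rowSum w j + w i j
      ≈⟨ solve 4 (λ s c r x → s :- c :- r :+ x := s :- r :- c :+ x) refl _ _ _ _ ⟩
    distanceOperator w j i
      ≈⟨ eigen j i (λ j≡i → i≢j (≡.sym j≡i)) ⟩
    _ ∎

  -- The equation is summed over the n - 1 positions j ≠ i: the constant part gives (n - 1)(2S -
  -- Rᵢ), the column sums give -(S - Cᵢ), and the transposed entries give Cᵢ.
  rowSum-eigenarray : ∀ {n z} {w : Array n} → Eigenarray z w → ∀ i →
    z * rowSum w i ≈ (ι (+ 2) * ι (+ n) - ι (+ 3)) * total w
                     - (ι (+ n) - ι 1ℤ) * rowSum w i + ι (+ 2) * colSum w i
  rowSum-eigenarray {n} {z} {w} (diag , eigen) i = begin
    z * rowSum w i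
      ≈⟨ *-distribˡ-sum z (w i) ⟩
    sum (λ j → z * w i j)
      ≈⟨ solve 3 (λ a b c → a := (b :+ c) :- ((b :+ c) :- a)) refl _ (sum (Dw i)) (z * w i i) ⟩
    (sum (Dw i) + z * w i i) - ((sum (Dw i) + z * w i i) - sum (λ j → z * w i j))
      ≈⟨ +-congˡ (-‿cong (+-congʳ (sum-agreeOff i (Dw i) (λ j → z * w i j)
           (λ j j≢i → eigen i j (λ i≡j → j≢i (≡.sym i≡j)))))) ⟩
    (sum (Dw i) + z * w i i) - ((sum (λ j → z * w i j) + Dw i i) - sum (λ j → z * w i j))
      ≈⟨ solve 4 (λ a b c d → (a :+ b) :- ((c :+ d) :- c) := a :+ b :- d) refl _ _ _ _ ⟩
    sum (Dw i) + z * w i i - Dw i i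
      ≈⟨ +-cong (+-cong sum-Dw (*-congˡ (diag i))) (-‿cong (+-congˡ (diag i))) ⟩
    (ι (+ n) * (ι (+ 2) * S - rowSum w i) - S + colSum w i) + z * 0#
      - (ι (+ 2) * S - rowSum w i - colSum w i + 0#)
      -- The solver recognises zero only as the image of the integer 0.
      ≈⟨ +-cong (+-congˡ (*-congˡ 0-homo)) (-‿cong (+-congˡ 0-homo)) ⟨
    (ι (+ n) * (ι (+ 2) * S - rowSum w i) - S + colSum w i) + z * ι 0ℤ
      - (ι (+ 2) * S - rowSum w i - colSum w i + ι 0ℤ)
      ≈⟨ solve 5 (λ n s r c z →
           (n :* (con (+ 2) :* s :- r) :- s :+ c) :+ z :* con 0ℤ
             :- (con (+ 2) :* s :- r :- c :+ con 0ℤ)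
           := (con (+ 2) :* n :- con (+ 3)) :* s :- (n :- con 1ℤ) :* r :+ con (+ 2) :* c)
           refl (ι (+ n)) S (rowSum w i) (colSum w i) z ⟩
    _ ∎
    where
    S = total w
    Dw = distanceOperator w
    sum-Dw : sum (Dw i) ≈ ι (+ n) * (ι (+ 2) * S - rowSum w i) - S + colSum w i
    sum-Dw = begin
      sum (Dw i)
        ≈⟨ ∑-distrib-+ {n} _ _ ⟩
      sum (λ j → ι (+ 2) * S - rowSum w i - colSum w j) + colSum w i
        ≈⟨ +-congʳ (sum-distrib-- {n} _ _) ⟩
      sum {n} (λ j → ι (+ 2) * S - rowSum w i) - sum (colSum w) + colSum w i
        ≈⟨ +-congʳ (+-cong (sum-const n _) (-‿cong (∑-comm (transpose w)))) ⟩
      _ ∎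

  ι-2n²-4n+3 : ∀ n → ι (+ 2 ℤ.* (+ n ℤ.* + n) ℤ.- + 4 ℤ.* + n ℤ.+ + 3) ≈
    ι (+ 2) * (ι (+ n) * ι (+ n)) - ι (+ 4) * ι (+ n) + ι (+ 3)
  ι-2n²-4n+3 n =
    trans (+-homo _ _) (+-congʳ (trans (+-homo _ _) (+-cong
      (trans (*-homo _ _) (*-congˡ (*-homo _ _)))
      (trans (-‿homo _) (-‿cong (*-homo _ _))))))

  -- Summing the row identity over i leaves only multiples of S, with coefficient n(2n - 3) - (n -
  -- 1) + 2.
  total-eigenarray : ∀ {n z} {w : Array n} → Eigenarray z w →
    z * total w ≈ ι (+ 2 ℤ.* (+ n ℤ.* + n) ℤ.- + 4 ℤ.* + n ℤ.+ + 3) * total w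
  total-eigenarray {n} {z} {w} eig = begin
    z * S
      ≈⟨ *-distribˡ-sum z (rowSum w) ⟩
    sum (λ i → z * rowSum w i)
      ≈⟨ sum-cong-≋ (rowSum-eigenarray eig) ⟩
    sum (λ i → (ι (+ 2) * N - ι (+ 3)) * S - (N - ι 1ℤ) * rowSum w i + ι (+ 2) * colSum w i)
      ≈⟨ ∑-distrib-+ {n} _ _ ⟩
    sum (λ i → (ι (+ 2) * N - ι (+ 3)) * S - (N - ι 1ℤ) * rowSum w i) + sum (λ i → ι (+ 2) * colSum w i)
      ≈⟨ +-cong (sum-distrib-- {n} _ _) (sym (*-distribˡ-sum _ (colSum w))) ⟩
    sum {n} (λ i → (ι (+ 2) * N - ι (+ 3)) * S) - sum (λ i → (N - ι 1ℤ) * rowSum w i) + ι (+ 2) * sum (colSum w)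
      ≈⟨ +-cong (+-cong (sum-const n _) (-‿cong (sym (*-distribˡ-sum _ (rowSum w)))))
                (*-congˡ (∑-comm (transpose w))) ⟩
    N * ((ι (+ 2) * N - ι (+ 3)) * S) - (N - ι 1ℤ) * S + ι (+ 2) * S
      ≈⟨ solve 2 (λ n s → n :* ((con (+ 2) :* n :- con (+ 3)) :* s) :- (n :- con 1ℤ) :* s :+ con (+ 2) :* s
                        := (con (+ 2) :* (n :* n) :- con (+ 4) :* n :+ con (+ 3)) :* s) refl N S ⟩
    (ι (+ 2) * (N * N) - ι (+ 4) * N + ι (+ 3)) * S
      ≈⟨ *-congʳ (ι-2n²-4n+3 n) ⟨
    _ ∎
    where
    S = total w
    N = ι (+ n)

  -- Non-zero-divisors; in ℂ every number apart from 0 is one.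
  Regular : Carrier → Set _
  Regular x = ∀ y → x * y ≈ 0# → y ≈ 0#

  -- Each stage of the elimination cancels one factor z - m: the last listed value kills S, the
  -- second and the first kill R + C and R - C, the fourth and the third kill w + wᵀ and w - wᵀ.
  -- Regularity of 2 recovers a quantity from a sum and a difference.
  eigenarray-trivial : ∀ {n z} {w : Array n} → Regular (ι (+ 2)) →
    (∀ {m} → m ∈ spectrum n → Regular (z - ι m)) → Eigenarray z w → ∀ i j → w i j ≈ 0#
  eigenarray-trivial {n} {z} {w} regular₂ regular eig@(diag , eigen) = w≈0
    where
    N = ι (+ n)

    cancel : ∀ {m y} → m ∈ spectrum n → z * y ≈ ι m * y → y ≈ 0#
    cancel {m} {y} m∈ zy≈my = regular m∈ y (begin
      (z - ι m) * y        ≈⟨ solve 3 (λ z m y → (z :- m) :* y := z :* y :- m :* y) refl z (ι m) y ⟩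
      z * y - ι m * y      ≈⟨ +-congʳ zy≈my ⟩
      ι m * y - ι m * y    ≈⟨ -‿inverseʳ _ ⟩
      0#                   ∎)

    ≈0-fromSumDifference : ∀ {x y} → x + y ≈ 0# → x - y ≈ 0# → x ≈ 0#
    ≈0-fromSumDifference {x} {y} x+y≈0 x-y≈0 = regular₂ x (begin
      ι (+ 2) * x        ≈⟨ solve 2 (λ x y → con (+ 2) :* x := (x :+ y) :+ (x :- y)) refl x y ⟩
      (x + y) + (x - y)  ≈⟨ +-cong x+y≈0 x-y≈0 ⟩
      0# + 0#            ≈⟨ +-identityˡ 0# ⟩
      0#                 ∎)

    total≈0 : total w ≈ 0#
    total≈0 = cancel (there (there (there (there (here ≡.refl))))) (total-eigenarray eig)

    z*rowSum : ∀ {w : Array n} → total w ≈ 0# → Eigenarray z w → ∀ i →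
      z * rowSum w i ≈ ι (+ 2) * colSum w i - (N - ι 1ℤ) * rowSum w i
    z*rowSum {w} S≈0 eig i = begin
      z * rowSum w i
        ≈⟨ rowSum-eigenarray eig i ⟩
      (ι (+ 2) * N - ι (+ 3)) * total w - (N - ι 1ℤ) * rowSum w i + ι (+ 2) * colSum w i
        ≈⟨ +-congʳ (+-congʳ (trans (*-congˡ S≈0) (zeroʳ _))) ⟩
      0# - (N - ι 1ℤ) * rowSum w i + ι (+ 2) * colSum w i
        ≈⟨ +-congʳ (+-identityˡ _) ⟩
      -ᴿ ((N - ι 1ℤ) * rowSum w i) + ι (+ 2) * colSum w i
        ≈⟨ +-comm _ _ ⟩
      _ ∎

    z*colSum : ∀ i → z * colSum w i ≈ ι (+ 2) * rowSum w i - (N - ι 1ℤ) * colSum w i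
    z*colSum = z*rowSum (trans (∑-comm (transpose w)) total≈0) (transpose-eigenarray eig)

    row+col≈0 : ∀ i → rowSum w i + colSum w i ≈ 0#
    row+col≈0 i = cancel (there (here ≡.refl)) (begin
      z * (r + c)                                                          ≈⟨ distribˡ z r c ⟩
      z * r + z * c                                                        ≈⟨ +-cong (z*rowSum total≈0 eig i) (z*colSum i) ⟩
      (ι (+ 2) * c - (N - ι 1ℤ) * r) + (ι (+ 2) * r - (N - ι 1ℤ) * c)      ≈⟨ solve 3 (λ n r c →
        (con (+ 2) :* c :- (n :- con 1ℤ) :* r) :+ (con (+ 2) :* r :- (n :- con 1ℤ) :* c)
        := (:- n :+ con (+ 3)) :* (r :+ c)) refl N r c ⟩
      (-ᴿ N + ι (+ 3)) * (r + c)                                           ≈⟨ *-congʳ (trans (+-homo _ _) (+-congʳ (-‿homo _))) ⟨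
      ι (- + n ℤ.+ + 3) * (r + c)                                          ∎)
      where r = rowSum w i ; c = colSum w i

    row-col≈0 : ∀ i → rowSum w i - colSum w i ≈ 0#
    row-col≈0 i = cancel (here ≡.refl) (begin
      z * (r - c)                                                          ≈⟨ solve 3 (λ z r c → z :* (r :- c) := z :* r :- z :* c) refl z r c ⟩
      z * r - z * c                                                        ≈⟨ +-cong (z*rowSum total≈0 eig i) (-‿cong (z*colSum i)) ⟩
      (ι (+ 2) * c - (N - ι 1ℤ) * r) - (ι (+ 2) * r - (N - ι 1ℤ) * c)      ≈⟨ solve 3 (λ n r c →
        (con (+ 2) :* c :- (n :- con 1ℤ) :* r) :- (con (+ 2) :* r :- (n :- con 1ℤ) :* c)
        := (:- n :- con 1ℤ) :* (r :- c)) refl N r c ⟩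
      (-ᴿ N - ι (+ 1)) * (r - c)                                           ≈⟨ *-congʳ (trans (+-homo _ _) (+-cong (-‿homo _) (-‿homo _))) ⟨
      ι (- + n ℤ.- + 1) * (r - c)                                          ∎)
      where r = rowSum w i ; c = colSum w i

    rowSum≈0 : ∀ i → rowSum w i ≈ 0#
    rowSum≈0 i = ≈0-fromSumDifference (row+col≈0 i) (row-col≈0 i)

    colSum≈0 : ∀ i → colSum w i ≈ 0#
    colSum≈0 i = trans (sym (+-identityˡ _)) (trans (+-congʳ (sym (rowSum≈0 i))) (row+col≈0 i))

    -- Once all sums vanish, the operator is transposition. On the diagonal, where the eigenvalue
    -- equation says nothing, both sides are zero.
    z*w≈wᵀ : ∀ i j → z * w i j ≈ w j i
    z*w≈wᵀ i j with i Fin.≟ j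
    ... | yes ≡.refl = trans (trans (*-congˡ (diag i)) (zeroʳ z)) (sym (diag i))
    ... | no i≢j = begin
      z * w i j                                                ≈⟨ eigen i j i≢j ⟨
      ι (+ 2) * total w - rowSum w i - colSum w j + w j i      ≈⟨ +-congʳ (+-cong (+-cong (*-congˡ total≈0) (-‿cong (rowSum≈0 i))) (-‿cong (colSum≈0 j))) ⟩
      ι (+ 2) * 0# - 0# - 0# + w j i                           ≈⟨ +-congʳ (+-cong (+-cong (*-congˡ 0-homo) (-‿cong 0-homo)) (-‿cong 0-homo)) ⟨
      ι (+ 2) * ι 0ℤ - ι 0ℤ - ι 0ℤ + w j i                     ≈⟨ solve 1 (λ x → con (+ 2) :* con 0ℤ :- con 0ℤ :- con 0ℤ :+ x := x) refl (w j i) ⟩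
      w j i                                                    ∎

    w≈0 : ∀ i j → w i j ≈ 0#
    w≈0 i j = ≈0-fromSumDifference
      (cancel (there (there (there (here ≡.refl)))) (begin
        z * (w i j + w j i)        ≈⟨ distribˡ z _ _ ⟩
        z * w i j + z * w j i      ≈⟨ +-cong (z*w≈wᵀ i j) (z*w≈wᵀ j i) ⟩
        w j i + w i j              ≈⟨ solve 2 (λ x y → y :+ x := con 1ℤ :* (x :+ y)) refl _ _ ⟩
        ι 1ℤ * (w i j + w j i)     ∎))
      (cancel (there (there (here ≡.refl))) (begin
        z * (w i j - w j i)        ≈⟨ solve 3 (λ z x y → z :* (x :- y) := z :* x :- z :* y) refl z _ _ ⟩
        z * w i j - z * w j i      ≈⟨ +-cong (z*w≈wᵀ i j) (-‿cong (z*w≈wᵀ j i)) ⟩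
        w j i - w i j              ≈⟨ solve 2 (λ x y → y :- x := con -1ℤ :* (x :- y)) refl _ _ ⟩
        ι -1ℤ * (w i j - w j i)    ∎))

  -- Eigenarrays for the five values

  -- The diagonal is subtracted by a δ factor and not removed by a case split, so that row and
  -- column sums follow from linearity.
  offDiagonal : ∀ {n} → Array n → Array n
  offDiagonal w i j = w i j - ι (δ i j) * w i j

  offDiagonal-zeroDiagonal : ∀ {n} (w : Array n) → ZeroDiagonal (offDiagonal w)
  offDiagonal-zeroDiagonal w i =
    trans (+-congˡ (-‿cong (trans (*-congʳ (ι-δ-refl i)) (*-identityˡ _)))) (-‿inverseʳ _)

  offDiagonal-≢ : ∀ {n} (w : Array n) {i j} → i ≢ j → offDiagonal w i j ≈ w i j
  offDiagonal-≢ w {i} {j} i≢j = begin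
    w i j - ι (δ i j) * w i j    ≈⟨ +-congˡ (-‿cong (*-congʳ (reflexive (≡.cong ι (δ-≢ i≢j))))) ⟩
    w i j - ι 0ℤ * w i j         ≈⟨ solve 1 (λ x → x :- con 0ℤ :* x := x) refl (w i j) ⟩
    w i j                        ∎

  rowSum-offDiagonal : ∀ {n} (w : Array n) i → rowSum (offDiagonal w) i ≈ rowSum w i - w i i
  rowSum-offDiagonal {n} w i = trans (sum-distrib-- {n} _ _) (+-congˡ (-‿cong (sum-δ i (w i))))

  colSum-offDiagonal : ∀ {n} (w : Array n) j → colSum (offDiagonal w) j ≈ colSum w j - w j j
  colSum-offDiagonal w j = trans
    (sum-cong-≋ (λ i → +-congˡ (-‿cong (*-congʳ (reflexive (≡.cong ι (δ-sym i j)))))))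
    (rowSum-offDiagonal (transpose w) j)

  distanceOperator-≈ : ∀ {n} (w : Array n) {i j t r c x} → total w ≈ t → rowSum w i ≈ r →
    colSum w j ≈ c → w j i ≈ x → distanceOperator w i j ≈ ι (+ 2) * t - r - c + x
  distanceOperator-≈ w t r c x = +-cong (+-cong (+-cong (*-congˡ t) (-‿cong r)) (-‿cong c)) x

  Eigenarray-respˡ : ∀ {n z z′} {w : Array n} → z ≈ z′ → Eigenarray z w → Eigenarray z′ w
  Eigenarray-respˡ z≈z′ (diag , eigen) = diag , λ i j i≢j → trans (eigen i j i≢j) (*-congʳ z≈z′)

  -- The graph is transmission regular: with total n(n - 1) and all line sums n - 1, the distances
  -- from any vertex add up to 2n(n - 1) - 2(n - 1) + 1.
  offDiagonal-1-eigenarray : ∀ n →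
    Eigenarray (ι (+ 2 ℤ.* (+ n ℤ.* + n) ℤ.- + 4 ℤ.* + n ℤ.+ + 3)) (offDiagonal {n} (λ _ _ → 1#))
  offDiagonal-1-eigenarray n = offDiagonal-zeroDiagonal 𝟙 , λ i j i≢j → begin
    distanceOperator w i j
      ≈⟨ distanceOperator-≈ w (trans (sum-cong-≋ line) (sum-const n _)) (line i)
           (trans (colSum-offDiagonal 𝟙 j) sum-line)
           (trans (offDiagonal-≢ 𝟙 (λ j≡i → i≢j (≡.sym j≡i))) (sym 1-homo)) ⟩
    ι (+ 2) * (N * (N * ι 1ℤ - ι 1ℤ)) - (N * ι 1ℤ - ι 1ℤ) - (N * ι 1ℤ - ι 1ℤ) + ι 1ℤ
      ≈⟨ solve 1 (λ n → con (+ 2) :* (n :* (n :* con 1ℤ :- con 1ℤ)) :- (n :* con 1ℤ :- con 1ℤ)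
                          :- (n :* con 1ℤ :- con 1ℤ) :+ con 1ℤ
                      := (con (+ 2) :* (n :* n) :- con (+ 4) :* n :+ con (+ 3)) :* con 1ℤ) refl N ⟩
    (ι (+ 2) * (N * N) - ι (+ 4) * N + ι (+ 3)) * ι 1ℤ
      ≈⟨ *-cong (ι-2n²-4n+3 n) (trans (offDiagonal-≢ 𝟙 i≢j) (sym 1-homo)) ⟨
    _ ∎
    where
    N = ι (+ n)
    𝟙 w : Array n
    𝟙 _ _ = 1#
    w = offDiagonal 𝟙
    sum-line : sum {n} (λ _ → 1#) - 1# ≈ N * ι 1ℤ - ι 1ℤ
    sum-line = +-cong (trans (sum-const n 1#) (*-congˡ (sym 1-homo))) (-‿cong (sym 1-homo))
    line : ∀ i → rowSum w i ≈ N * ι 1ℤ - ι 1ℤ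
    line i = trans (rowSum-offDiagonal 𝟙 i) sum-line

  sum-*ˡ≈0 : ∀ {n} x (f : Fin n → Carrier) → sum f ≈ 0# → sum (λ i → x * f i) ≈ 0#
  sum-*ˡ≈0 x f Σf≈0 = trans (sym (*-distribˡ-sum x f)) (trans (*-congˡ Σf≈0) (zeroʳ x))

  sum-*ʳ≈0 : ∀ {n} x (f : Fin n → Carrier) → sum f ≈ 0# → sum (λ i → f i * x) ≈ 0#
  sum-*ʳ≈0 x f Σf≈0 = trans (sym (*-distribʳ-sum x f)) (trans (*-congʳ Σf≈0) (zeroˡ x))

  -- The parameter `s`, a square root of 1, treats the symmetric and the antisymmetric array at
  -- once.
  additiveArray : ∀ {n} → Carrier → (Fin n → Carrier) → Array n
  additiveArray s p i j = p i + s * p j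

  -- Eigenvalue 3 − n for s = 1 and −n − 1 for s = −1.
  additiveArray-eigenarray : ∀ {n} s {p : Fin n → Carrier} → s * s ≈ 1# → sum p ≈ 0# →
    Eigenarray (-ᴿ ι (+ n) + ι 1ℤ + ι (+ 2) * s) (offDiagonal (additiveArray s p))
  additiveArray-eigenarray {n} s {p} s²≈1 Σp≈0 = offDiagonal-zeroDiagonal F , λ i j i≢j → begin
    distanceOperator w i j
      ≈⟨ distanceOperator-≈ w (trans (sum-cong-≋ row) (trans (sum-*ˡ≈0 (N - ι 1ℤ - s) p Σp≈0) (sym 0-homo))) (row i) (col j)
           (offDiagonal-≢ F (λ j≡i → i≢j (≡.sym j≡i))) ⟩
    ι (+ 2) * ι 0ℤ - (N - ι 1ℤ - s) * p i - (s * N - ι 1ℤ - s) * p j + (p j + s * p i)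
      -- The solver cannot use s² = 1, so the defect 2(1 - s²)pⱼ is split off here and shown to
      -- vanish in the next steps.
      ≈⟨ solve 4 (λ n s x y →
           con (+ 2) :* con 0ℤ :- (n :- con 1ℤ :- s) :* x :- (s :* n :- con 1ℤ :- s) :* y :+ (y :+ s :* x)
           := (:- n :+ con 1ℤ :+ con (+ 2) :* s) :* (x :+ s :* y) :+ con (+ 2) :* (con 1ℤ :- s :* s) :* y)
           refl N s (p i) (p j) ⟩
    (-ᴿ N + ι 1ℤ + ι (+ 2) * s) * F i j + ι (+ 2) * (ι 1ℤ - s * s) * p j
      ≈⟨ +-congˡ (*-congʳ (*-congˡ (+-congˡ (-‿cong (trans s²≈1 (sym 1-homo)))))) ⟩
    (-ᴿ N + ι 1ℤ + ι (+ 2) * s) * F i j + ι (+ 2) * (ι 1ℤ - ι 1ℤ) * p j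
      ≈⟨ solve 2 (λ x y → x :+ con (+ 2) :* (con 1ℤ :- con 1ℤ) :* y := x) refl _ _ ⟩
    (-ᴿ N + ι 1ℤ + ι (+ 2) * s) * F i j
      ≈⟨ *-congˡ (offDiagonal-≢ F i≢j) ⟨
    _ ∎
    where
    N = ι (+ n)
    F = additiveArray s p
    w = offDiagonal F
    row : ∀ i → rowSum w i ≈ (N - ι 1ℤ - s) * p i
    row i = begin
      rowSum w i
        ≈⟨ rowSum-offDiagonal F i ⟩
      rowSum F i - (p i + s * p i)
        ≈⟨ +-congʳ (trans (∑-distrib-+ {n} _ _) (+-cong (sum-const n (p i)) (sum-*ˡ≈0 s p Σp≈0))) ⟩
      N * p i + 0# - (p i + s * p i)
        ≈⟨ +-congʳ (+-identityʳ _) ⟩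
      N * p i - (p i + s * p i)
        ≈⟨ solve 3 (λ n s x → n :* x :- (x :+ s :* x) := (n :- con 1ℤ :- s) :* x) refl N s (p i) ⟩
      _ ∎
    col : ∀ j → colSum w j ≈ (s * N - ι 1ℤ - s) * p j
    col j = begin
      colSum w j
        ≈⟨ colSum-offDiagonal F j ⟩
      colSum F j - (p j + s * p j)
        ≈⟨ +-congʳ (trans (∑-distrib-+ {n} _ _) (+-cong Σp≈0 (sum-const n (s * p j)))) ⟩
      0# + N * (s * p j) - (p j + s * p j)
        ≈⟨ +-congʳ (+-identityˡ _) ⟩
      N * (s * p j) - (p j + s * p j)
        ≈⟨ solve 3 (λ n s x → n :* (s :* x) :- (x :+ s :* x) := (s :* n :- con 1ℤ :- s) :* x) refl N s (p j) ⟩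
      _ ∎

  multiplicativeArray : ∀ {n} → Carrier → (p q : Fin n → Carrier) → Array n
  multiplicativeArray s p q i j = p i * q j + s * q i * p j

  -- All row and column sums vanish because p and q have sum zero, so the operator reduces to
  -- transposition, which multiplies this array by `s`. The diagonal vanishes because p and q have
  -- disjoint supports.
  multiplicativeArray-eigenarray : ∀ {n} s {p q : Fin n → Carrier} → s * s ≈ 1# →
    sum p ≈ 0# → sum q ≈ 0# → (∀ i → p i * q i ≈ 0#) →
    Eigenarray s (multiplicativeArray s p q)
  multiplicativeArray-eigenarray {n} s {p} {q} s²≈1 Σp≈0 Σq≈0 pq≈0 = diag , λ i j _ → begin
    distanceOperator w i j
      ≈⟨ distanceOperator-≈ w (trans (sum-≈0 row) (sym 0-homo)) (trans (row i) (sym 0-homo))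
           (trans (col j) (sym 0-homo)) refl ⟩
    ι (+ 2) * ι 0ℤ - ι 0ℤ - ι 0ℤ + w j i
      ≈⟨ solve 5 (λ s a b c d →
           con (+ 2) :* con 0ℤ :- con 0ℤ :- con 0ℤ :+ (c :* b :+ s :* d :* a)
           := s :* (a :* d :+ s :* b :* c) :+ (con 1ℤ :- s :* s) :* (b :* c))
           refl s (p i) (q i) (p j) (q j) ⟩
    s * w i j + (ι 1ℤ - s * s) * (q i * p j)
      ≈⟨ +-congˡ (*-congʳ (+-congˡ (-‿cong (trans s²≈1 (sym 1-homo))))) ⟩
    s * w i j + (ι 1ℤ - ι 1ℤ) * (q i * p j)
      ≈⟨ solve 2 (λ x y → x :+ (con 1ℤ :- con 1ℤ) :* y := x) refl _ _ ⟩
    s * w i j ∎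
    where
    w = multiplicativeArray s p q
    diag : ZeroDiagonal w
    diag i = begin
      p i * q i + s * q i * p i      ≈⟨ solve 3 (λ s x y → x :* y :+ s :* y :* x := (con 1ℤ :+ s) :* (x :* y)) refl s (p i) (q i) ⟩
      (ι 1ℤ + s) * (p i * q i)       ≈⟨ *-congˡ (pq≈0 i) ⟩
      (ι 1ℤ + s) * 0#                ≈⟨ zeroʳ _ ⟩
      0#                             ∎
    row : ∀ i → rowSum w i ≈ 0#
    row i = trans (∑-distrib-+ {n} _ _)
      (trans (+-cong (sum-*ˡ≈0 (p i) q Σq≈0) (sum-*ˡ≈0 (s * q i) p Σp≈0)) (+-identityˡ 0#))
    col : ∀ j → colSum w j ≈ 0#
    col j = trans (∑-distrib-+ {n} _ _)
      (trans (+-cong (sum-*ʳ≈0 (q j) p Σp≈0) (sum-*ʳ≈0 (p j) (λ i → s * q i) (sum-*ˡ≈0 s q Σq≈0))) (+-identityˡ 0#))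

  -- The position (i₀ , i₁) certifies that the eigenarrays built from p and q are nonzero: their
  -- entry there is 1.
  record TestVectors (n : ℕ) : Set (a ⊔ ℓ) where
    field
      p q       : Fin n → Carrier
      Σp≈0      : sum p ≈ 0#
      Σq≈0      : sum q ≈ 0#
      pq≈0      : ∀ i → p i * q i ≈ 0#
      i₀ i₁     : Fin n
      i₀≢i₁     : i₀ ≢ i₁
      p₀≈1      : p i₀ ≈ 1#
      q₁≈1      : q i₁ ≈ 1#
      p₁≈0      : p i₁ ≈ 0#
      q₀≈0      : q i₀ ≈ 0#

  -- A vector of sum zero with an entry 1 occupies at least two indices, so two such vectors with
  -- disjoint supports require four.
  testVectors : ∀ {n} → 3 < n → TestVectors n
  testVectors {suc (suc (suc (suc m)))} (s≤s (s≤s (s≤s (s≤s _)))) = record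
    { p = p ; q = q
    ; Σp≈0 = trans (+-congˡ (+-congˡ (+-congˡ (+-congˡ tail≈0))))
        -- Here 1 and 0 are solver variables: the entries 1 and -1 cancel and a sum of zeros
        -- remains.
        (trans (solve 2 (λ o z → o :+ (z :+ (:- o :+ (z :+ z))) := z :+ z :+ z) refl 1# 0#) 0+0+0≈0)
    ; Σq≈0 = trans (+-congˡ (+-congˡ (+-congˡ (+-congˡ tail≈0))))
        (trans (solve 2 (λ o z → z :+ (o :+ (z :+ (:- o :+ z))) := z :+ z :+ z) refl 1# 0#) 0+0+0≈0)
    ; pq≈0 = pq≈0
    ; i₀ = zero ; i₁ = suc zero ; i₀≢i₁ = λ ()
    ; p₀≈1 = refl ; q₁≈1 = refl ; p₁≈0 = refl ; q₀≈0 = refl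
    }
    where
    p q : Fin (suc (suc (suc (suc m)))) → Carrier
    p zero                      = 1#
    p (suc zero)                = 0#
    p (suc (suc zero))          = -ᴿ 1#
    p (suc (suc (suc _)))       = 0#
    q zero                      = 0#
    q (suc zero)                = 1#
    q (suc (suc zero))          = 0#
    q (suc (suc (suc zero)))    = -ᴿ 1#
    q (suc (suc (suc (suc _)))) = 0#
    tail≈0 : sum {m} (λ _ → 0#) ≈ 0#
    tail≈0 = sum-replicate-zero m
    0+0+0≈0 : 0# + 0# + 0# ≈ 0#
    0+0+0≈0 = trans (+-identityʳ _) (+-identityʳ 0#)
    pq≈0 : ∀ i → p i * q i ≈ 0#
    pq≈0 zero                      = zeroʳ _
    pq≈0 (suc zero)                = zeroˡ _
    pq≈0 (suc (suc zero))          = zeroʳ _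
    pq≈0 (suc (suc (suc zero)))    = zeroˡ _
    pq≈0 (suc (suc (suc (suc _)))) = zeroˡ _

  -- An abstract ring has no apartness, so being nonzero is witnessed by an off-diagonal entry equal
  -- to 1.
  IsArrayEigenvalue : ℕ → Carrier → Set (a ⊔ ℓ)
  IsArrayEigenvalue n z =
    ∃[ w ] Eigenarray {n} z w × (∃₂ λ i j → i ≢ j × w i j ≈ 1#)

  isArrayEigenvalue-resp-≈ : ∀ {n z z′} → z ≈ z′ → IsArrayEigenvalue n z → IsArrayEigenvalue n z′
  isArrayEigenvalue-resp-≈ z≈z′ (w , eigenarray , nonzero) = w , Eigenarray-respˡ z≈z′ eigenarray , nonzero

  spectrum⇒eigenvalue : ∀ {n m} → 3 < n → m ∈ spectrum n → IsArrayEigenvalue n (ι m)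
  spectrum⇒eigenvalue {n} {m} 3<n = λ where
      (here ≡.refl) → additive -1ℤ ≡.refl (begin
        -ᴿ N + ι 1ℤ + ι (+ 2) * ι -1ℤ
          ≈⟨ solve 1 (λ n → :- n :+ con 1ℤ :+ con (+ 2) :* con -1ℤ := :- n :- con 1ℤ) refl N ⟩
        -ᴿ N - ι 1ℤ
          ≈⟨ trans (+-homo _ _) (+-cong (-‿homo _) (-‿homo _)) ⟨
        _ ∎)
      (there (here ≡.refl)) → additive 1ℤ ≡.refl (begin
        -ᴿ N + ι 1ℤ + ι (+ 2) * ι 1ℤ
          ≈⟨ solve 1 (λ n → :- n :+ con 1ℤ :+ con (+ 2) :* con 1ℤ := :- n :+ con (+ 3)) refl N ⟩
        -ᴿ N + ι (+ 3)
          ≈⟨ trans (+-homo _ _) (+-congʳ (-‿homo _)) ⟨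
        _ ∎)
      (there (there (here ≡.refl)))         → multiplicative -1ℤ ≡.refl
      (there (there (there (here ≡.refl)))) → multiplicative 1ℤ ≡.refl
      (there (there (there (there (here ≡.refl))))) →
        _ , offDiagonal-1-eigenarray n , _ , _ , i₀≢i₁ , offDiagonal-≢ _ i₀≢i₁
    where
    open TestVectors (testVectors 3<n)
    N = ι (+ n)
    square : ∀ ε → ε ℤ.* ε ≡ 1ℤ → ι ε * ι ε ≈ 1#
    square ε ε²≡1 = trans (sym (*-homo ε ε)) (trans (reflexive (≡.cong ι ε²≡1)) 1-homo)
    additive : ∀ ε {z} → ε ℤ.* ε ≡ 1ℤ → -ᴿ N + ι 1ℤ + ι (+ 2) * ι ε ≈ z → IsArrayEigenvalue n z
    additive ε ε²≡1 z≈ =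
      _ , Eigenarray-respˡ z≈ (additiveArray-eigenarray (ι ε) (square ε ε²≡1) Σp≈0)
        , _ , _ , i₀≢i₁
        , trans (offDiagonal-≢ (additiveArray (ι ε) p) i₀≢i₁)
            (trans (+-cong p₀≈1 (trans (*-congˡ p₁≈0) (zeroʳ _))) (+-identityʳ 1#))
    multiplicative : ∀ ε → ε ℤ.* ε ≡ 1ℤ → IsArrayEigenvalue n (ι ε)
    multiplicative ε ε²≡1 =
      _ , multiplicativeArray-eigenarray (ι ε) (square ε ε²≡1) Σp≈0 Σq≈0 pq≈0
        , _ , _ , i₀≢i₁
        , trans (+-cong (trans (*-cong p₀≈1 q₁≈1) (*-identityˡ 1#)) (trans (*-congˡ p₁≈0) (zeroʳ _)))
            (+-identityʳ 1#)

  -- Vectors on the vertices and arrays with zero diagonal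

  module _ {n k} (pairs : OffDiagonal n k) where
    open OffDiagonal pairs

    -- Each summand is written as a double sum weighted by δ, and the sums are exchanged. A pair i ≠
    -- j is then hit by exactly one vertex, and a diagonal pair by none, where `w` vanishes anyway.
    sum-offDiagonalPairs : (w : Array n) → ZeroDiagonal w →
      sum (λ a → w (row a) (col a)) ≈ total w
    sum-offDiagonalPairs w diag = begin
      sum (λ a → w (row a) (col a))
        ≈⟨ sum-cong-≋ (λ a → sum-δ (row a) (λ i → w i (col a))) ⟨
      sum (λ a → sum (λ i → ι (δ (row a) i) * w i (col a)))
        ≈⟨ sum-cong-≋ (λ a → sum-cong-≋ (λ i → trans
             (*-congˡ (sym (sum-δ (col a) (w i)))) (*-distribˡ-sum {n} _ (λ j → ι (δ (col a) j) * w i j)))) ⟩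
      sum (λ a → sum (λ i → sum (λ j → term a i j)))
        ≈⟨ ∑-comm {k} {n} _ ⟩
      sum (λ i → sum (λ a → sum (λ j → term a i j)))
        ≈⟨ sum-cong-≋ (λ i → ∑-comm (λ a → term a i)) ⟩
      sum (λ i → sum (λ j → sum (λ a → term a i j)))
        ≈⟨ sum-cong-≋ (λ i → sum-cong-≋ (λ j → sum-term i j)) ⟩
      total w ∎
      where
      term : Fin k → Array n
      term a i j = ι (δ (row a) i) * (ι (δ (col a) j) * w i j)
      term≈0 : ∀ {a i j} → (row a ≡ i → col a ≢ j) → term a i j ≈ 0#
      term≈0 {a} {i} {j} a≢ij with row a Fin.≟ i
      ... | no row≢i  = trans (*-congʳ 0-homo) (zeroˡ _)
      ... | yes row≡i = trans (*-congˡ (trans (*-congʳ (ι-δ-≢ (a≢ij row≡i))) (zeroˡ _))) (zeroʳ _)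
      sum-term : ∀ i j → sum (λ a → term a i j) ≈ w i j
      sum-term i j with i Fin.≟ j
      ... | yes ≡.refl = trans
        (sum-≈0 {k} (λ a → term≈0 (λ row≡i col≡i → row≢col a (≡.trans row≡i (≡.sym col≡i)))))
        (sym (diag i))
      ... | no i≢j with index i≢j
      ... | a , ≡.refl , ≡.refl = begin
        sum (λ b → term b i j)
          ≈⟨ sum-single a _ (λ b b≢a → term≈0 (λ row≡ col≡ → b≢a (injective row≡ col≡))) ⟩
        ι (δ i i) * (ι (δ j j) * w i j)
          ≈⟨ *-cong (ι-δ-refl i) (*-congʳ (ι-δ-refl j)) ⟩
        1# * (1# * w i j)
          ≈⟨ trans (*-identityˡ _) (*-identityˡ _) ⟩
        w i j ∎

    -- Each δ in the distance formula collapses a sum: the two linear terms select a row sum and a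
    -- column sum, and the product selects the transposed entry. The formula may be used on the
    -- diagonal too, since `w` is zero there.
    sum-distance : (w : Array n) → ZeroDiagonal w → ∀ a →
      sum (λ b → ι (distanceℤ a b) * w (row b) (col b)) ≈ distanceOperator w (row a) (col a)
    sum-distance w diag a = begin
      sum (λ b → F (row b) (col b))
        ≈⟨ sum-offDiagonalPairs F (λ i → trans (*-congˡ (diag i)) (zeroʳ _)) ⟩
      total F
        ≈⟨ sum-cong-≋ rowSum-F ⟩
      sum (λ i → ι (+ 2) * rowSum w i - ι (δ r i) * rowSum w i - w i c + ι (δ c i) * w i r)
        ≈⟨ ∑-distrib-+ {n} _ _ ⟩
      sum (λ i → ι (+ 2) * rowSum w i - ι (δ r i) * rowSum w i - w i c) + sum (λ i → ι (δ c i) * w i r)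
        ≈⟨ +-cong (trans (sum-distrib-- {n} _ _) (+-congʳ (trans (sum-distrib-- {n} _ _)
             (+-cong (sym (*-distribˡ-sum _ (rowSum w))) (-‿cong (sum-δ r (rowSum w)))))))
             (sum-δ c (λ i → w i r)) ⟩
      distanceOperator w r c ∎
      where
      r = row a
      c = col a
      F : Array n
      F i j = ι (+ 2 ℤ.- δ r i ℤ.- δ c j ℤ.+ δ r j ℤ.* δ c i) * w i j
      F-expand : ∀ i j → F i j ≈
        (ι (+ 2) - ι (δ r i)) * w i j - ι (δ c j) * w i j + ι (δ c i) * (ι (δ r j) * w i j)
      F-expand i j = trans
        (*-congʳ (trans (+-homo _ _) (+-cong
          (trans (+-homo _ _) (+-cong (trans (+-homo _ _) (+-congˡ (-‿homo _))) (-‿homo _)))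
          (*-homo _ _))))
        (solve 5 (λ e f g h x → (con (+ 2) :- e :- f :+ g :* h) :* x
                    := (con (+ 2) :- e) :* x :- f :* x :+ h :* (g :* x)) refl _ _ _ _ _)
      rowSum-F : ∀ i → rowSum F i ≈
        ι (+ 2) * rowSum w i - ι (δ r i) * rowSum w i - w i c + ι (δ c i) * w i r
      rowSum-F i = begin
        sum (F i)
          ≈⟨ sum-cong-≋ (F-expand i) ⟩
        sum (λ j → (ι (+ 2) - ι (δ r i)) * w i j - ι (δ c j) * w i j + ι (δ c i) * (ι (δ r j) * w i j))
          ≈⟨ trans (∑-distrib-+ {n} _ _) (+-congʳ (sum-distrib-- {n} _ _)) ⟩
        sum (λ j → (ι (+ 2) - ι (δ r i)) * w i j) - sum (λ j → ι (δ c j) * w i j)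
          + sum (λ j → ι (δ c i) * (ι (δ r j) * w i j))
          ≈⟨ +-cong (+-cong (sym (*-distribˡ-sum _ (w i))) (-‿cong (sum-δ c (w i))))
               (trans (sym (*-distribˡ-sum {n} _ (λ j → ι (δ r j) * w i j))) (*-congˡ (sum-δ r (w i)))) ⟩
        (ι (+ 2) - ι (δ r i)) * rowSum w i - w i c + ι (δ c i) * w i r
          ≈⟨ solve 4 (λ e s x y → (con (+ 2) :- e) :* s :- x :+ y := con (+ 2) :* s :- e :* s :- x :+ y)
               refl _ _ _ _ ⟩
        _ ∎

    -- The default 0 keeps the diagonal out of every sum.
    fill : (Fin k → Carrier) → Array n
    fill v i j with i Fin.≟ j
    ... | yes _  = 0#
    ... | no i≢j = v (proj₁ (index i≢j))

    fill-zeroDiagonal : ∀ v → ZeroDiagonal (fill v)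
    fill-zeroDiagonal v i with i Fin.≟ i
    ... | yes _  = refl
    ... | no i≢i = contradiction ≡.refl i≢i

    -- The vertex returned by `index` may depend on the given proof of inequality; injectivity of
    -- the coordinates identifies it with `a` all the same.
    fill-pair : ∀ v a → fill v (row a) (col a) ≡ v a
    fill-pair v a with row a Fin.≟ col a
    ... | yes row≡col = contradiction row≡col (row≢col a)
    ... | no row≢col with index row≢col
    ... | b , row≡ , col≡ = ≡.cong v (injective row≡ col≡)

    module _ {M : Fin k → Fin k → Carrier} (M≈ι : ∀ a b → M a b ≈ ι (distanceℤ a b)) where

      eigenvector⇒eigenarray : ∀ {z} v →
        (∀ a → sum (λ b → M a b * v b) ≈ z * v a) → Eigenarray z (fill v)
      eigenvector⇒eigenarray {z} v eigen = fill-zeroDiagonal v , off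
        where
        off : ∀ i j → i ≢ j → distanceOperator (fill v) i j ≈ z * fill v i j
        off i j i≢j with index i≢j
        ... | a , ≡.refl , ≡.refl = begin
          distanceOperator (fill v) (row a) (col a)
            ≈⟨ sum-distance (fill v) (fill-zeroDiagonal v) a ⟨
          sum (λ b → ι (distanceℤ a b) * fill v (row b) (col b))
            ≈⟨ sum-cong-≋ (λ b → *-cong (M≈ι a b) (reflexive (≡.sym (fill-pair v b)))) ⟨
          sum (λ b → M a b * v b)
            ≈⟨ eigen a ⟩
          z * v a
            ≈⟨ *-congˡ (reflexive (fill-pair v a)) ⟨
          _ ∎

      eigenarray⇒eigenvector : ∀ {z w} → Eigenarray z w → ∀ a →
        sum (λ b → M a b * w (row b) (col b)) ≈ z * w (row a) (col a)
      eigenarray⇒eigenvector {w = w} (diag , eigen) a =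
        trans (sum-cong-≋ (λ b → *-congʳ (M≈ι a b)))
          (trans (sum-distance w diag a) (eigen _ _ (row≢col a)))

    pair-≈ : ∀ (w : Array n) {i j x} → i ≢ j → w i j ≈ x → ∃[ a ] w (row a) (col a) ≈ x
    pair-≈ w i≢j wij≈x with index i≢j
    ... | a , ≡.refl , ≡.refl = a , wij≈x

-- Distances in the line graph

avoidTwo : ∀ {n} → 2 < n → {i j : Fin n} → i ≢ j → ∃[ m ] m ≢ i × m ≢ j
avoidTwo {suc (suc (suc _))} (s≤s (s≤s (s≤s _))) {i} {j} i≢j =
  punchIn i m , Fin.punchInᵢ≢i i m ,
  λ m≡j → Fin.punchInᵢ≢i (punchOut i≢j) zero (Fin.punchIn-injective i _ _
    (≡.trans m≡j (≡.sym (Fin.punchIn-punchOut i≢j))))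
  -- An index different from the place of j among the indices without i; reinserting i makes it
  -- avoid both.
  where m = punchIn (punchOut i≢j) zero

module Distance {n k} (2<n : 2 < n) (G : Graph k) (pairs : OffDiagonal n k)
  (adjacent⁺ : ∀ {a b} → a ≢ b → OffDiagonal.Aligned pairs a b → Adj G a b)
  (adjacent⁻ : ∀ {a b} → Adj G a b → OffDiagonal.Aligned pairs a b)
  where

  open OffDiagonal pairs

  distanceℤ-≡ : ∀ {a b e f g h} → δ (row a) (row b) ≡ e → δ (col a) (col b) ≡ f →
    δ (row a) (col b) ≡ g → δ (col a) (row b) ≡ h →
    + 2 ℤ.- e ℤ.- f ℤ.+ g ℤ.* h ≡ distanceℤ a b
  distanceℤ-≡ ≡.refl ≡.refl ≡.refl ≡.refl = ≡.refl

  adjacent-distance : ∀ {a b} → a ≢ b → Aligned a b → IsDistance G a b 1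
  adjacent-distance a≢b shared = adjacent⁺ a≢b shared ∷ [] , λ where
    zero    []  → contradiction ≡.refl a≢b
    (suc _) _   → s≤s z≤n

  far : ∀ {a b} → row a ≢ row b → col a ≢ col b → ∀ l → Walk G a b l → 2 ℕ.≤ l
  far row≢ col≢ zero          []        = contradiction ≡.refl row≢
  far row≢ col≢ (suc zero)    (e ∷ [])  = contradiction (adjacent⁻ e) [ row≢ , col≢ ]′
  far row≢ col≢ (suc (suc _)) _         = s≤s (s≤s z≤n)

  corner-distance : ∀ {a b} c → row a ≢ row b → col a ≢ col b →
    row a ≡ row c × col c ≡ col b ⊎ col a ≡ col c × row c ≡ row b → IsDistance G a b 2
  corner-distance c row≢ col≢ (inj₁ (row≡ , col≡)) =
    adjacent⁺ (λ { ≡.refl → col≢ col≡ }) (inj₁ row≡) ∷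
    adjacent⁺ (λ { ≡.refl → row≢ row≡ }) (inj₂ col≡) ∷ [] , far row≢ col≢
  corner-distance c row≢ col≢ (inj₂ (col≡ , row≡)) =
    adjacent⁺ (λ { ≡.refl → row≢ row≡ }) (inj₂ col≡) ∷
    adjacent⁺ (λ { ≡.refl → col≢ col≡ }) (inj₁ row≡) ∷ [] , far row≢ col≢

  -- With a = (i , j), b = (j , i) and a third index m, the walk is (i , j), (i , m), (j , m), (j ,
  -- i).
  swapped-distance : ∀ {a b} → row a ≡ col b → col a ≡ row b → IsDistance G a b 3
  swapped-distance {a} {b} row≡col col≡row = walk , bound
    where
    row≢ : row a ≢ row b
    row≢ row≡ = row≢col b (≡.trans (≡.sym row≡) row≡col)

    col≢ : col a ≢ col b
    col≢ col≡ = row≢col a (≡.trans row≡col (≡.sym col≡))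

    walk : Walk G a b 3
    walk with avoidTwo 2<n (row≢col a)
    ... | m , m≢row , m≢col
      with index {row a} {m} (m≢row ∘ ≡.sym) | index {col a} {m} (m≢col ∘ ≡.sym)
    ... | c , c-row , c-col | d , d-row , d-col =
      adjacent⁺ (λ { ≡.refl → m≢col (≡.sym c-col) }) (inj₁ (≡.sym c-row)) ∷
      adjacent⁺ (λ { ≡.refl → row≢col a (≡.trans (≡.sym c-row) d-row) }) (inj₂ (≡.trans c-col (≡.sym d-col))) ∷
      adjacent⁺ (λ { ≡.refl → m≢row (≡.trans (≡.sym d-col) (≡.sym row≡col)) }) (inj₁ (≡.trans d-row col≡row)) ∷ []

    bound : ∀ l → Walk G a b l → 3 ℕ.≤ l
    bound zero                []           = contradiction ≡.refl row≢
    bound (suc zero)          (e ∷ [])     = contradiction (adjacent⁻ e) [ row≢ , col≢ ]′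
    bound (suc (suc (suc _))) _            = s≤s (s≤s (s≤s z≤n))
    -- Two steps of the same kind would give a and b a common coordinate; two of different kinds
    -- would pass through a diagonal corner.
    bound (suc (suc zero))    (_∷_ {v = c} e (f ∷ [])) with adjacent⁻ e | adjacent⁻ f
    ... | inj₁ a-c | inj₁ c-b = contradiction (≡.trans a-c c-b) row≢
    ... | inj₂ a-c | inj₂ c-b = contradiction (≡.trans a-c c-b) col≢
    ... | inj₁ a-c | inj₂ c-b = contradiction (≡.trans (≡.sym a-c) (≡.trans row≡col (≡.sym c-b))) (row≢col c)
    ... | inj₂ a-c | inj₁ c-b = contradiction (≡.trans c-b (≡.trans (≡.sym col≡row) a-c)) (row≢col c)

  -- The corner (row a , col b) is tried before (row b , col a); each is a vertex unless its
  -- coordinates agree, so only the swapped pair is left without a corner.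
  distance : ∀ a b → ∃[ d ] IsDistance G a b d × + d ≡ distanceℤ a b
  distance a b = cases (row a Fin.≟ row b) (col a Fin.≟ col b) (row a Fin.≟ col b) (col a Fin.≟ row b)
    where
    cases : Dec (row a ≡ row b) → Dec (col a ≡ col b) → Dec (row a ≡ col b) → Dec (col a ≡ row b) →
      ∃[ d ] IsDistance G a b d × + d ≡ distanceℤ a b
    -- When the third δ is 0 the product computes to 0, so the fourth δ can stay unevaluated.
    cases (yes row≡) (yes col≡) _ _ = 0 ,
      ≡.subst (λ c → IsDistance G a c 0) (injective row≡ col≡) ([] , λ _ _ → z≤n) ,
      distanceℤ-≡ (δ-≡ row≡) (δ-≡ col≡)
        (δ-≢ (λ row≡col → row≢col a (≡.trans row≡col (≡.sym col≡)))) ≡.refl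
    cases (yes row≡) (no col≢) _ _ = 1 , adjacent-distance (col≢ ∘ ≡.cong col) (inj₁ row≡) ,
      distanceℤ-≡ (δ-≡ row≡) (δ-≢ col≢)
        (δ-≢ (λ row≡col → row≢col b (≡.trans (≡.sym row≡) row≡col))) ≡.refl
    cases (no row≢) (yes col≡) _ _ = 1 , adjacent-distance (row≢ ∘ ≡.cong row) (inj₂ col≡) ,
      distanceℤ-≡ (δ-≢ row≢) (δ-≡ col≡)
        (δ-≢ (λ row≡col → row≢col a (≡.trans row≡col (≡.sym col≡)))) ≡.refl
    cases (no row≢) (no col≢) (no row≢col′) _ = let c , c-row , c-col = index row≢col′ in
      2 , corner-distance c row≢ col≢ (inj₁ (≡.sym c-row , c-col)) ,
      distanceℤ-≡ (δ-≢ row≢) (δ-≢ col≢) (δ-≢ row≢col′) ≡.refl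
    cases (no row≢) (no col≢) (yes row≡col) (no col≢row) = let c , c-row , c-col = index (col≢row ∘ ≡.sym) in
      2 , corner-distance c row≢ col≢ (inj₂ (≡.sym c-col , c-row)) ,
      distanceℤ-≡ (δ-≢ row≢) (δ-≢ col≢) (δ-≡ row≡col) (δ-≢ col≢row)
    cases (no row≢) (no col≢) (yes row≡col) (yes col≡row) = 3 , swapped-distance row≡col col≡row ,
      distanceℤ-≡ (δ-≢ row≢) (δ-≢ col≢) (δ-≡ row≡col) (δ-≡ col≡row)

  distanceMatrix-unique : ∀ {D : Matrix ℕ k} → IsDistanceMatrix G D → ∀ a b → + D a b ≡ distanceℤ a b
  distanceMatrix-unique isD a b =
    let d , (walk , shortest) , d≡ = distance a b
        walk′ , shortest′ = isD a b
    in ≡.trans (≡.cong +_ (ℕ.≤-antisym (shortest′ d walk) (shortest _ walk′))) d≡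

-- Edges as positions in the edge list

lookup-injective : ∀ {A : Set} {xs : List A} → Unique xs → ∀ {a b} → lookup xs a ≡ lookup xs b → a ≡ b
lookup-injective (_ ∷ _)       {zero}  {zero}  _  = ≡.refl
lookup-injective {xs = _ ∷ xs} (x∉xs ∷ _) {zero}  {suc b} eq = contradiction eq (All.lookup x∉xs (List.∈-lookup b))
lookup-injective {xs = _ ∷ xs} (x∉xs ∷ _) {suc a} {zero}  eq = contradiction (≡.sym eq) (All.lookup x∉xs (List.∈-lookup a))
lookup-injective (_ ∷ unique)  {suc a} {suc b} eq = ≡.cong suc (lookup-injective unique eq)

module LineGraph {k} (G : Graph k) where

  edge : Fin (length (edges G)) → Fin k × Fin k
  edge = lookup (edges G)

  edge-isEdge : ∀ a → IsEdge G (edge a)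
  edge-isEdge a = proj₂ (List.∈-filter⁻ (isEdge? G) {xs = cartesianProduct (allFin k) (allFin k)} (List.∈-lookup a))

  edge-injective : ∀ {a b} → edge a ≡ edge b → a ≡ b
  edge-injective = lookup-injective
    (Unique.filter⁺ (isEdge? G) (Unique.cartesianProduct⁺ (Unique.allFin⁺ k) (Unique.allFin⁺ k)))

  edge-surjective : ∀ {e} → IsEdge G e → ∃[ a ] edge a ≡ e
  edge-surjective {u , v} isEdge = Any.index e∈ , ≡.sym (lookup-index e∈)
    where
    e∈ : (u , v) ∈ edges G
    e∈ = List.∈-filter⁺ (isEdge? G) (List.∈-cartesianProduct⁺ (List.∈-allFin u) (List.∈-allFin v)) isEdge

-- Edges of the crown graph as off-diagonal pairs

module CrownLineGraph (n : ℕ) where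
  open LineGraph (crown n)

  ↑ˡ<↑ʳ : ∀ (i j : Fin n) → i ↑ˡ n Fin.< n ↑ʳ j
  ↑ˡ<↑ʳ i j = begin-strict
    Fin.toℕ (i ↑ˡ n)    ≡⟨ Fin.toℕ-↑ˡ i n ⟩
    Fin.toℕ i           <⟨ Fin.toℕ<n i ⟩
    n                   ≤⟨ ℕ.m≤m+n n _ ⟩
    n ℕ.+ Fin.toℕ j     ≡⟨ Fin.toℕ-↑ʳ n j ⟨
    Fin.toℕ (n ↑ʳ j)    ∎
    where open ℕ.≤-Reasoning

  ↑ˡ≢↑ʳ : ∀ {i j : Fin n} → i ↑ˡ n ≢ n ↑ʳ j
  ↑ˡ≢↑ʳ {i} {j} = Fin.<⇒≢ (↑ˡ<↑ʳ i j)

  pairEdge : Fin n × Fin n → Fin (n ℕ.+ n) × Fin (n ℕ.+ n)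
  pairEdge (i , j) = i ↑ˡ n , n ↑ʳ j

  pairEdge-isEdge : ∀ {i j} → i ≢ j → IsEdge (crown n) (pairEdge (i , j))
  pairEdge-isEdge {i} {j} i≢j = ↑ˡ<↑ʳ i j , adj
    where
    adj : CrownAdj (splitAt n (i ↑ˡ n)) (splitAt n (n ↑ʳ j))
    adj rewrite Fin.splitAt-↑ˡ n i n | Fin.splitAt-↑ʳ n n j = i≢j

  -- Edges list their smaller endpoint before the larger, and the left side of the crown precedes
  -- the right side, so the left endpoint always comes first and the coordinates are unambiguous.
  isEdge⇒pairEdge : ∀ {e} → IsEdge (crown n) e → ∃₂ λ i j → i ≢ j × e ≡ pairEdge (i , j)
  isEdge⇒pairEdge {u , v} (u<v , adj) with splitAt n u in u≡ | splitAt n v in v≡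
  ... | inj₁ i | inj₂ j = i , j , adj ,
    ≡.cong₂ _,_ (≡.sym (Fin.splitAt⁻¹-↑ˡ u≡)) (≡.sym (Fin.splitAt⁻¹-↑ʳ v≡))
  ... | inj₂ j | inj₁ i = contradiction
    (≡.subst₂ Fin._<_ (≡.sym (Fin.splitAt⁻¹-↑ʳ u≡)) (≡.sym (Fin.splitAt⁻¹-↑ˡ v≡)) u<v)
    (Fin.<-asym (↑ˡ<↑ʳ i j))

  row col : Fin (length (edges (crown n))) → Fin n
  row a = proj₁ (isEdge⇒pairEdge (edge-isEdge a))
  col a = proj₁ (proj₂ (isEdge⇒pairEdge (edge-isEdge a)))

  edge≡ : ∀ a → edge a ≡ pairEdge (row a , col a)
  edge≡ a = proj₂ (proj₂ (proj₂ (isEdge⇒pairEdge (edge-isEdge a))))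

  pairs : OffDiagonal n (length (edges (crown n)))
  pairs = record
    { row       = row
    ; col       = col
    ; row≢col   = λ a → proj₁ (proj₂ (proj₂ (isEdge⇒pairEdge (edge-isEdge a))))
    ; injective = λ {a} {b} row≡ col≡ → edge-injective
        (≡.trans (edge≡ a) (≡.trans (≡.cong₂ (λ i j → pairEdge (i , j)) row≡ col≡) (≡.sym (edge≡ b))))
    ; index     = λ i≢j → let a , a≡ = edge-surjective (pairEdge-isEdge i≢j)
                              row≡ , col≡ = ,-injective (≡.trans (≡.sym (edge≡ a)) a≡)
                          in a , Fin.↑ˡ-injective n _ _ row≡ , Fin.↑ʳ-injective n _ _ col≡
    }

  adjacent⁺ : ∀ {a b} → a ≢ b → row a ≡ row b ⊎ col a ≡ col b → Adj (lineGraph (crown n)) a b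
  adjacent⁺ {a} {b} a≢b shared = a≢b ,
    ≡.subst₂ ShareEndpoint (≡.sym (edge≡ a)) (≡.sym (edge≡ b)) (share shared)
    where
    share : row a ≡ row b ⊎ col a ≡ col b → ShareEndpoint (pairEdge (row a , col a)) (pairEdge (row b , col b))
    share (inj₁ row≡) = row a ↑ˡ n , inj₁ ≡.refl , inj₁ (≡.cong (_↑ˡ n) row≡)
    share (inj₂ col≡) = n ↑ʳ col a , inj₂ ≡.refl , inj₂ (≡.cong (n ↑ʳ_) col≡)

  adjacent⁻ : ∀ {a b} → Adj (lineGraph (crown n)) a b → row a ≡ row b ⊎ col a ≡ col b
  adjacent⁻ {a} {b} (_ , shared) =
    unshare (≡.subst₂ ShareEndpoint (edge≡ a) (edge≡ b) shared)
    where
    unshare : ShareEndpoint (pairEdge (row a , col a)) (pairEdge (row b , col b)) → row a ≡ row b ⊎ col a ≡ col b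
    unshare (_ , inj₁ ≡.refl , inj₁ eq) = inj₁ (Fin.↑ˡ-injective n _ _ eq)
    unshare (_ , inj₁ ≡.refl , inj₂ eq) = contradiction eq ↑ˡ≢↑ʳ
    unshare (_ , inj₂ ≡.refl , inj₁ eq) = contradiction (≡.sym eq) ↑ˡ≢↑ʳ
    unshare (_ , inj₂ ≡.refl , inj₂ eq) = inj₂ (Fin.↑ʳ-injective n _ _ eq)

-- Real numbers

open ℚ.+-*-Solver using (solve; con; _:+_; _:-_; _:*_; :-_; _:=_)

Near : ℚ → ℝ → ℝ → Set
Near ε x y = ∃[ N ] (∀ n → N ℕ.≤ n → ℚ.∣ seq x n ℚ.- seq y n ∣ ℚ.< ε)

≗⇒≈ℝ : ∀ {x y} → (∀ n → seq x n ≡ seq y n) → x ≈ℝ y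
≗⇒≈ℝ {x} {y} x≗y ε 0<ε = 0 , λ n _ → ≡.subst (ℚ._< ε)
  (≡.sym (≡.trans (≡.cong (λ p → ℚ.∣ p ℚ.- seq y n ∣) (x≗y n)) (≡.cong ℚ.∣_∣ (ℚ.+-inverseʳ (seq y n))))) 0<ε

∣p-q∣≡∣q-p∣ : ∀ p q → ℚ.∣ p ℚ.- q ∣ ≡ ℚ.∣ q ℚ.- p ∣
∣p-q∣≡∣q-p∣ p q = ≡.trans (≡.sym (ℚ.∣-p∣≡∣p∣ (p ℚ.- q)))
  (≡.cong ℚ.∣_∣ (solve 2 (λ p q → :- (p :- q) := q :- p) ≡.refl p q))

≈ℝ-refl : ∀ {x} → x ≈ℝ x
≈ℝ-refl {x} = ≗⇒≈ℝ {x} {x} (λ _ → ≡.refl)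

≈ℝ-sym : ∀ {x y} → x ≈ℝ y → y ≈ℝ x
≈ℝ-sym {x} {y} x≈y ε 0<ε = map₂
  (λ close n N≤n → ≡.subst (ℚ._< ε) (∣p-q∣≡∣q-p∣ (seq x n) (seq y n)) (close n N≤n)) (x≈y ε 0<ε)

near-+ : ∀ {x y x′ y′ : ℝ} ε (z w : ℝ) → Near (½ ℚ.* ε) x x′ → Near (½ ℚ.* ε) y y′ →
  (∀ n → (seq x n ℚ.- seq x′ n) ℚ.+ (seq y n ℚ.- seq y′ n) ≡ seq z n ℚ.- seq w n) → Near ε z w
near-+ ε z w (N₁ , close₁) (N₂ , close₂) eq = N₁ ℕ.⊔ N₂ , λ n N≤n →
  ≡.subst (λ p → ℚ.∣ p ∣ ℚ.< ε) (eq n)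
    (sum-small ε _ _ (close₁ n (ℕ.m⊔n≤o⇒m≤o N₁ N₂ N≤n)) (close₂ n (ℕ.m⊔n≤o⇒n≤o N₁ N₂ N≤n)))

≈ℝ-trans : ∀ {x y z} → x ≈ℝ y → y ≈ℝ z → x ≈ℝ z
≈ℝ-trans {x} {y} {z} x≈y y≈z ε 0<ε =
  near-+ {x} {y} {y} {z} ε x z (x≈y _ (½-pos 0<ε)) (y≈z _ (½-pos 0<ε))
    (λ n → solve 3 (λ x y z → (x :- y) :+ (y :- z) := x :- z) ≡.refl (seq x n) (seq y n) (seq z n))

+ℝ-cong : ∀ {x x′ y y′} → x ≈ℝ x′ → y ≈ℝ y′ → x +ℝ y ≈ℝ x′ +ℝ y′
+ℝ-cong {x} {x′} {y} {y′} x≈x′ y≈y′ ε 0<ε =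
  near-+ {x} {y} {x′} {y′} ε (x +ℝ y) (x′ +ℝ y′) (x≈x′ _ (½-pos 0<ε)) (y≈y′ _ (½-pos 0<ε))
    (λ n → ≡.sym (+-rearrange (seq x n) (seq y n) (seq x′ n) (seq y′ n)))

-ℝ_ : ℝ → ℝ
-ℝ x = mkℝ (λ n → ℚ.- seq x n) (neg-cauchy (seq x) (cauchy x))

-ℝ-cong : ∀ {x y} → x ≈ℝ y → -ℝ x ≈ℝ -ℝ y
-ℝ-cong {x} {y} x≈y ε 0<ε = map₂ (λ close n N≤n → ≡.subst (ℚ._< ε)
  (≡.sym (≡.trans (≡.cong ℚ.∣_∣ (neg-rearrange (seq x n) (seq y n))) (ℚ.∣-p∣≡∣p∣ _))) (close n N≤n)) (x≈y ε 0<ε)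

-- Multiplying by a convergent, hence bounded, sequence preserves nullity.
near-* : ∀ {x y} (z : ℝ) → x ≈ℝ y → ∀ ε → 0ℚ ℚ.< ε →
  ∃[ N ] (∀ n → N ℕ.≤ n → ℚ.∣ seq z n ℚ.* (seq x n ℚ.- seq y n) ∣ ℚ.< ε)
near-* z x≈y ε 0<ε =
  let B , 0<B , M , bound = eventuallyBounded (seq z) (cauchy z)
      η , 0<η , small = product-small B 0<B ε 0<ε
      N , close = x≈y η 0<η
  in M ℕ.⊔ N , λ n N≤n →
    small _ _ (bound n (ℕ.m⊔n≤o⇒m≤o M N N≤n)) (close n (ℕ.m⊔n≤o⇒n≤o M N N≤n))

*ℝ-cong : ∀ {x x′ y y′} → x ≈ℝ x′ → y ≈ℝ y′ → x *ℝ y ≈ℝ x′ *ℝ y′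
*ℝ-cong {x} {x′} {y} {y′} x≈x′ y≈y′ ε 0<ε =
  let N₁ , close₁ = near-* {y} {y′} x y≈y′ _ (½-pos 0<ε)
      N₂ , close₂ = near-* {x} {x′} y′ x≈x′ _ (½-pos 0<ε)
  in N₁ ℕ.⊔ N₂ , λ n N≤n → ≡.subst (λ p → ℚ.∣ p ∣ ℚ.< ε)
    (≡.sym (*-rearrange (seq x n) (seq y n) (seq x′ n) (seq y′ n)))
    (sum-small ε _ _ (close₁ n (ℕ.m⊔n≤o⇒m≤o N₁ N₂ N≤n)) (close₂ n (ℕ.m⊔n≤o⇒n≤o N₁ N₂ N≤n)))

-- Closeness, apartness and cancellation for reals

½-< : ∀ {ε} → 0ℚ ℚ.< ε → ½ ℚ.* ε ℚ.< ε
½-< {ε} 0<ε = ≡.subst₂ ℚ._<_ (ℚ.+-identityʳ (½ ℚ.* ε)) (½ε+½ε ε) (ℚ.+-monoʳ-< (½ ℚ.* ε) (½-pos 0<ε))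

-- The slack makes the alternative decidable: past a stage N the difference varies by less than ¼ε,
-- so comparing the single rational at N with ½ε keeps the tail either below ε or above ¼ε.
near⊎apart : ∀ x y ε → 0ℚ ℚ.< ε → Near ε x y ⊎ x #ℝ y
near⊎apart x y ε 0<ε = decide (cauchy (x -ℝ y) ¼ε 0<¼ε)
  where
  open ℚ.≤-Reasoning
  d : ℕ → ℚ
  d = seq (x -ℝ y)
  ¼ε : ℚ
  ¼ε = ½ ℚ.* (½ ℚ.* ε)
  0<¼ε : 0ℚ ℚ.< ¼ε
  0<¼ε = ½-pos (½-pos 0<ε)
  decide : ∃[ N ] (∀ m n → N ℕ.≤ m → N ℕ.≤ n → ℚ.∣ d m ℚ.- d n ∣ ℚ.< ¼ε) → Near ε x y ⊎ x #ℝ y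
  decide (N , close) = compare (ℚ.∣ d N ∣ ℚ.<? ½ ℚ.* ε)
    where
    compare : Dec (ℚ.∣ d N ∣ ℚ.< ½ ℚ.* ε) → Near ε x y ⊎ x #ℝ y
    compare (yes small) = inj₁ (N , λ n N≤n →
      ≡.subst (λ p → ℚ.∣ p ∣ ℚ.< ε) (≡.sym (split (d n) (d N)))
        (sum-small ε (d N) (d n ℚ.- d N) small
          (ℚ.<-trans (close n N N≤n ℕ.≤-refl) (½-< (½-pos 0<ε)))))
    compare (no large) = inj₂ (¼ε , 0<¼ε , N , λ n N≤n →
      ℚ.≰⇒> (λ d≤ → large (begin-strict
        ℚ.∣ d N ∣                            ≡⟨ ≡.cong ℚ.∣_∣ (split (d N) (d n)) ⟩
        ℚ.∣ d n ℚ.+ (d N ℚ.- d n) ∣          ≤⟨ ℚ.∣p+q∣≤∣p∣+∣q∣ (d n) (d N ℚ.- d n) ⟩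
        ℚ.∣ d n ∣ ℚ.+ ℚ.∣ d N ℚ.- d n ∣      <⟨ ℚ.+-mono-≤-< d≤ (close N n ℕ.≤-refl N≤n) ⟩
        ¼ε ℚ.+ ¼ε                              ≡⟨ ½ε+½ε (½ ℚ.* ε) ⟩
        ½ ℚ.* ε                              ∎)))

-- Tightness of apartness: for every ε the second alternative of `near⊎apart` is excluded.
¬#⇒≈ℝ : ∀ {x y} → ¬ (x #ℝ y) → x ≈ℝ y
¬#⇒≈ℝ {x} {y} ¬x#y ε 0<ε =
  [ id , (λ x#y → contradiction x#y ¬x#y) ]′ (near⊎apart x y ε 0<ε)

#⇒≉ℝ : ∀ {x y} → x #ℝ y → ¬ (x ≈ℝ y)
#⇒≉ℝ (ε , 0<ε , N , apart) x≈y =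
  let M , close = x≈y ε 0<ε
  in ℚ.<-asym (apart (N ℕ.⊔ M) (ℕ.m≤m⊔n N M)) (close (N ℕ.⊔ M) (ℕ.m≤n⊔m N M))

#⇒-#0 : ∀ {x y} → x #ℝ y → (x +ℝ (-ℝ y)) #ℝ 0ℝ
#⇒-#0 {x} {y} = map₂ (map₂ (map₂ (λ {N} apart n N≤n →
  ≡.subst (λ p → _ ℚ.< ℚ.∣ p ∣) (≡.sym (ℚ.+-identityʳ (seq x n ℚ.- seq y n))) (apart n N≤n))))

-- If |c| stays above ε, then |c x| < εη forces |x| < η.
regularℝ : ∀ {c x} → c #ℝ 0ℝ → c *ℝ x ≈ℝ 0ℝ → x ≈ℝ 0ℝ
regularℝ {c} {x} (ε , 0<ε , N , apart) cx≈0 η 0<η =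
  let M , close = cx≈0 (ε ℚ.* η) 0<εη
  in N ℕ.⊔ M , λ n N≤n → ℚ.*-cancelˡ-<-nonNeg ε (begin-strict
    ε ℚ.* ℚ.∣ seq x n ℚ.- 0ℚ ∣                      ≡⟨ ≡.cong (λ p → ε ℚ.* ℚ.∣ p ∣) (ℚ.+-identityʳ (seq x n)) ⟩
    ε ℚ.* ℚ.∣ seq x n ∣                             ≤⟨ ℚ.*-monoʳ-≤-nonNeg ℚ.∣ seq x n ∣ {{ℚ.∣-∣-nonNeg (seq x n)}}
                                                       (ℚ.<⇒≤ (apart n (ℕ.m⊔n≤o⇒m≤o N M N≤n))) ⟩
    ℚ.∣ seq c n ℚ.- 0ℚ ∣ ℚ.* ℚ.∣ seq x n ∣          ≡⟨ ≡.cong (λ p → ℚ.∣ p ∣ ℚ.* ℚ.∣ seq x n ∣) (ℚ.+-identityʳ (seq c n)) ⟩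
    ℚ.∣ seq c n ∣ ℚ.* ℚ.∣ seq x n ∣                 ≡⟨ ℚ.∣p*q∣≡∣p∣*∣q∣ (seq c n) (seq x n) ⟨
    ℚ.∣ seq c n ℚ.* seq x n ∣                       ≡⟨ ≡.cong ℚ.∣_∣ (ℚ.+-identityʳ (seq c n ℚ.* seq x n)) ⟨
    ℚ.∣ seq c n ℚ.* seq x n ℚ.- 0ℚ ∣                <⟨ close n (ℕ.m⊔n≤o⇒n≤o N M N≤n) ⟩
    ε ℚ.* η                                         ∎)
  where
  open ℚ.≤-Reasoning
  instance
    ε-pos : ℚ.Positive ε
    ε-pos = ℚ.positive 0<ε
    ε-nonNeg : ℚ.NonNegative ε
    ε-nonNeg = ℚ.pos⇒nonNeg ε
  0<εη : 0ℚ ℚ.< ε ℚ.* η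
  0<εη = ≡.subst (ℚ._< ε ℚ.* η) (ℚ.*-zeroʳ ε) (ℚ.*-monoʳ-<-pos ε 0<η)

p*p≡∣p∣*∣p∣ : ∀ p → p ℚ.* p ≡ ℚ.∣ p ∣ ℚ.* ℚ.∣ p ∣
p*p≡∣p∣*∣p∣ p with ℚ.∣p∣≡p∨∣p∣≡-p p
... | inj₁ eq rewrite eq = ≡.refl
... | inj₂ eq rewrite eq = solve 1 (λ p → p :* p := (:- p) :* (:- p)) ≡.refl p

0≤∣p∣*∣p∣ : ∀ p → 0ℚ ℚ.≤ ℚ.∣ p ∣ ℚ.* ℚ.∣ p ∣
0≤∣p∣*∣p∣ p = ≡.subst (ℚ._≤ ℚ.∣ p ∣ ℚ.* ℚ.∣ p ∣) (ℚ.*-zeroʳ ℚ.∣ p ∣)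
  (ℚ.*-monoˡ-≤-nonNeg ℚ.∣ p ∣ {{ℚ.∣-∣-nonNeg p}} (ℚ.0≤∣p∣ p))

-- Applied to the squared modulus of a complex number, of which only one part is known to be apart
-- from 0.
sumOfSquares-#0 : ∀ {x} y → x #ℝ 0ℝ → (x *ℝ x +ℝ y *ℝ y) #ℝ 0ℝ
sumOfSquares-#0 {x} y (ε , 0<ε , N , apart) = ε ℚ.* ε , 0<ε² , N , λ n N≤n →
  let p = seq x n ; q = seq y n
      ε<∣p∣ = ≡.subst (λ r → ε ℚ.< ℚ.∣ r ∣) (ℚ.+-identityʳ p) (apart n N≤n)
      p²+q² = p ℚ.* p ℚ.+ q ℚ.* q
      expand : p²+q² ≡ ℚ.∣ p ∣ ℚ.* ℚ.∣ p ∣ ℚ.+ ℚ.∣ q ∣ ℚ.* ℚ.∣ q ∣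
      expand = ≡.cong₂ ℚ._+_ (p*p≡∣p∣*∣p∣ p) (p*p≡∣p∣*∣p∣ q)
      ε²<p²+q² : ε ℚ.* ε ℚ.< p²+q²
      ε²<p²+q² = begin-strict
        ε ℚ.* ε                                          <⟨ ℚ.*-monoʳ-<-pos ε ε<∣p∣ ⟩
        ε ℚ.* ℚ.∣ p ∣                                    ≤⟨ ℚ.*-monoʳ-≤-nonNeg ℚ.∣ p ∣ {{ℚ.∣-∣-nonNeg p}} (ℚ.<⇒≤ ε<∣p∣) ⟩
        ℚ.∣ p ∣ ℚ.* ℚ.∣ p ∣                              ≡⟨ ℚ.+-identityʳ _ ⟨
        ℚ.∣ p ∣ ℚ.* ℚ.∣ p ∣ ℚ.+ 0ℚ                       ≤⟨ ℚ.+-monoʳ-≤ (ℚ.∣ p ∣ ℚ.* ℚ.∣ p ∣) (0≤∣p∣*∣p∣ q) ⟩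
        ℚ.∣ p ∣ ℚ.* ℚ.∣ p ∣ ℚ.+ ℚ.∣ q ∣ ℚ.* ℚ.∣ q ∣      ≡⟨ expand ⟨
        p²+q²                                            ∎
  in ≡.subst (ε ℚ.* ε ℚ.<_)
       (≡.sym (≡.trans (≡.cong ℚ.∣_∣ (ℚ.+-identityʳ p²+q²)) (ℚ.0≤p⇒∣p∣≡p (ℚ.<⇒≤ (ℚ.<-trans 0<ε² ε²<p²+q²)))))
       ε²<p²+q²
  where
  open ℚ.≤-Reasoning
  instance
    ε-pos : ℚ.Positive ε
    ε-pos = ℚ.positive 0<ε
  0<ε² : 0ℚ ℚ.< ε ℚ.* ε
  0<ε² = ≡.subst (ℚ._< ε ℚ.* ε) (ℚ.*-zeroʳ ε) (ℚ.*-monoʳ-<-pos ε 0<ε)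

-- The ring of complex numbers

infix 8 -ℂ_
-ℂ_ : ℂ → ℂ
-ℂ (x +i y) = (-ℝ x) +i (-ℝ y)

1ℂ : ℂ
1ℂ = fromℤ 1ℤ

≗⇒≈ℂ : ∀ {z w} → (∀ n → seq (re z) n ≡ seq (re w) n) → (∀ n → seq (im z) n ≡ seq (im w) n) → z ≈ℂ w
≗⇒≈ℂ {z} {w} re≗ im≗ = ≗⇒≈ℝ {re z} {re w} re≗ , ≗⇒≈ℝ {im z} {im w} im≗

≈ℂ-refl : ∀ {z} → z ≈ℂ z
≈ℂ-refl {z} = ≈ℝ-refl {re z} , ≈ℝ-refl {im z}

≈ℂ-sym : ∀ {z w} → z ≈ℂ w → w ≈ℂ z
≈ℂ-sym {a +i b} {c +i d} (a≈c , b≈d) = ≈ℝ-sym {a} {c} a≈c , ≈ℝ-sym {b} {d} b≈d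

≈ℂ-trans : ∀ {z w u} → z ≈ℂ w → w ≈ℂ u → z ≈ℂ u
≈ℂ-trans {a +i b} {c +i d} {e +i f} (a≈c , b≈d) (c≈e , d≈f) =
  ≈ℝ-trans {a} {c} {e} a≈c c≈e , ≈ℝ-trans {b} {d} {f} b≈d d≈f

+ℂ-cong : ∀ {z z′ w w′} → z ≈ℂ z′ → w ≈ℂ w′ → z +ℂ w ≈ℂ z′ +ℂ w′
+ℂ-cong {a +i b} {a′ +i b′} {c +i d} {c′ +i d′} (a≈ , b≈) (c≈ , d≈) =
  +ℝ-cong {a} {a′} {c} {c′} a≈ c≈ , +ℝ-cong {b} {b′} {d} {d′} b≈ d≈

*ℂ-cong : ∀ {z z′ w w′} → z ≈ℂ z′ → w ≈ℂ w′ → z *ℂ w ≈ℂ z′ *ℂ w′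
*ℂ-cong {a +i b} {a′ +i b′} {c +i d} {c′ +i d′} (a≈ , b≈) (c≈ , d≈) =
  +ℝ-cong {a *ℝ c} {a′ *ℝ c′} { -ℝ (b *ℝ d)} { -ℝ (b′ *ℝ d′)}
    (*ℝ-cong {a} {a′} {c} {c′} a≈ c≈)
    (-ℝ-cong {b *ℝ d} {b′ *ℝ d′} (*ℝ-cong {b} {b′} {d} {d′} b≈ d≈)) ,
  +ℝ-cong {a *ℝ d} {a′ *ℝ d′} {b *ℝ c} {b′ *ℝ c′}
    (*ℝ-cong {a} {a′} {d} {d′} a≈ d≈)
    (*ℝ-cong {b} {b′} {c} {c′} b≈ c≈)

-- Apart from the equivalence and congruence laws, the basic laws hold term by term for rational
-- sequences, so no estimates occur. Implicit arguments are supplied because `_≈ℝ_` unfolds to a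
-- statement about sequences from which the reals cannot be inferred.
ℂ-commutativeRing : CommutativeRing 0ℓ 0ℓ
ℂ-commutativeRing = record
  { Carrier = ℂ ; _≈_ = _≈ℂ_ ; _+_ = _+ℂ_ ; _*_ = _*ℂ_ ; -_ = -ℂ_ ; 0# = 0ℂ ; 1# = 1ℂ
  ; isCommutativeRing = record
    { isRing = record
      { +-isAbelianGroup = record
        { isGroup = record
          { isMonoid = record
            { isSemigroup = record
              { isMagma = record
                { isEquivalence = record { refl = λ {z} → ≈ℂ-refl {z} ; sym = λ {z} {w} → ≈ℂ-sym {z} {w} ; trans = λ {z} {w} {u} → ≈ℂ-trans {z} {w} {u} }
                ; ∙-cong = λ {z} {z′} {w} {w′} → +ℂ-cong {z} {z′} {w} {w′}
                }
              ; assoc = +-assoc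
              }
            ; identity = +-identityˡ , λ z → ≈ℂ-trans {z +ℂ 0ℂ} {0ℂ +ℂ z} {z} (+-comm z 0ℂ) (+-identityˡ z)
            }
          ; inverse = -‿inverseˡ , λ z → ≈ℂ-trans {z +ℂ -ℂ z} {(-ℂ z) +ℂ z} {0ℂ} (+-comm z (-ℂ z)) (-‿inverseˡ z)
          ; ⁻¹-cong = λ {z} {w} (a≈ , b≈) → -ℝ-cong {re z} {re w} a≈ , -ℝ-cong {im z} {im w} b≈
          }
        ; comm = +-comm
        }
      ; *-cong = λ {z} {z′} {w} {w′} → *ℂ-cong {z} {z′} {w} {w′}
      ; *-assoc = *-assoc
      ; *-identity = *-identityˡ , λ z → ≈ℂ-trans {z *ℂ 1ℂ} {1ℂ *ℂ z} {z} (*-comm z 1ℂ) (*-identityˡ z)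
      ; distrib = distribˡ , λ z w u → ≈ℂ-trans {(w +ℂ u) *ℂ z} {z *ℂ (w +ℂ u)} {w *ℂ z +ℂ u *ℂ z}
          (*-comm (w +ℂ u) z) (≈ℂ-trans {z *ℂ (w +ℂ u)} {z *ℂ w +ℂ z *ℂ u} {w *ℂ z +ℂ u *ℂ z} (distribˡ z w u)
            (+ℂ-cong {z *ℂ w} {w *ℂ z} {z *ℂ u} {u *ℂ z} (*-comm z w) (*-comm z u)))
      }
    ; *-comm = *-comm
    }
  }
  where
  +-assoc : ∀ z w u → (z +ℂ w) +ℂ u ≈ℂ z +ℂ (w +ℂ u)
  +-assoc z w u = ≗⇒≈ℂ {(z +ℂ w) +ℂ u} {z +ℂ (w +ℂ u)}
    (λ n → ℚ.+-assoc (seq (re z) n) (seq (re w) n) (seq (re u) n))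
    (λ n → ℚ.+-assoc (seq (im z) n) (seq (im w) n) (seq (im u) n))
  +-comm : ∀ z w → z +ℂ w ≈ℂ w +ℂ z
  +-comm z w = ≗⇒≈ℂ {z +ℂ w} {w +ℂ z}
    (λ n → ℚ.+-comm (seq (re z) n) (seq (re w) n)) (λ n → ℚ.+-comm (seq (im z) n) (seq (im w) n))
  +-identityˡ : ∀ z → 0ℂ +ℂ z ≈ℂ z
  +-identityˡ z = ≗⇒≈ℂ {0ℂ +ℂ z} {z}
    (λ n → ℚ.+-identityˡ (seq (re z) n)) (λ n → ℚ.+-identityˡ (seq (im z) n))
  -‿inverseˡ : ∀ z → (-ℂ z) +ℂ z ≈ℂ 0ℂ
  -‿inverseˡ z = ≗⇒≈ℂ {(-ℂ z) +ℂ z} {0ℂ}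
    (λ n → ℚ.+-inverseˡ (seq (re z) n)) (λ n → ℚ.+-inverseˡ (seq (im z) n))
  *-assoc : ∀ z w u → (z *ℂ w) *ℂ u ≈ℂ z *ℂ (w *ℂ u)
  *-assoc z w u = ≗⇒≈ℂ {(z *ℂ w) *ℂ u} {z *ℂ (w *ℂ u)}
    (λ n → solve 6 (λ a b c d e f →
      (a :* c :- b :* d) :* e :- (a :* d :+ b :* c) :* f
      := a :* (c :* e :- d :* f) :- b :* (c :* f :+ d :* e)) ≡.refl
      (seq (re z) n) (seq (im z) n) (seq (re w) n) (seq (im w) n) (seq (re u) n) (seq (im u) n))
    (λ n → solve 6 (λ a b c d e f →
      (a :* c :- b :* d) :* f :+ (a :* d :+ b :* c) :* e
      := a :* (c :* f :+ d :* e) :+ b :* (c :* e :- d :* f)) ≡.refl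
      (seq (re z) n) (seq (im z) n) (seq (re w) n) (seq (im w) n) (seq (re u) n) (seq (im u) n))
  *-comm : ∀ z w → z *ℂ w ≈ℂ w *ℂ z
  *-comm z w = ≗⇒≈ℂ {z *ℂ w} {w *ℂ z}
    (λ n → solve 4 (λ a b c d → a :* c :- b :* d := c :* a :- d :* b) ≡.refl
      (seq (re z) n) (seq (im z) n) (seq (re w) n) (seq (im w) n))
    (λ n → solve 4 (λ a b c d → a :* d :+ b :* c := c :* b :+ d :* a) ≡.refl
      (seq (re z) n) (seq (im z) n) (seq (re w) n) (seq (im w) n))
  *-identityˡ : ∀ z → 1ℂ *ℂ z ≈ℂ z
  *-identityˡ z = ≗⇒≈ℂ {1ℂ *ℂ z} {z}
    (λ n → solve 2 (λ a b → con 1ℚ :* a :- con 0ℚ :* b := a) ≡.refl (seq (re z) n) (seq (im z) n))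
    (λ n → solve 2 (λ a b → con 1ℚ :* b :+ con 0ℚ :* a := b) ≡.refl (seq (re z) n) (seq (im z) n))
  distribˡ : ∀ z w u → z *ℂ (w +ℂ u) ≈ℂ z *ℂ w +ℂ z *ℂ u
  distribˡ z w u = ≗⇒≈ℂ {z *ℂ (w +ℂ u)} {z *ℂ w +ℂ z *ℂ u}
    (λ n → solve 6 (λ a b c d e f →
      a :* (c :+ e) :- b :* (d :+ f) := (a :* c :- b :* d) :+ (a :* e :- b :* f)) ≡.refl
      (seq (re z) n) (seq (im z) n) (seq (re w) n) (seq (im w) n) (seq (re u) n) (seq (im u) n))
    (λ n → solve 6 (λ a b c d e f →
      a :* (d :+ f) :+ b :* (c :+ e) := (a :* d :+ b :* c) :+ (a :* f :+ b :* e)) ≡.refl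
      (seq (re z) n) (seq (im z) n) (seq (re w) n) (seq (im w) n) (seq (re u) n) (seq (im u) n))

-- Integers inside the complex numbers

-- Normalisation in ℚ does not compute on variable numerators; in ℚᵘ, fractions with denominator 1
-- add through their numerators.
/1-homo-+ : ∀ m n → (m ℤ.+ n) ℚ./ 1 ≡ m ℚ./ 1 ℚ.+ n ℚ./ 1
/1-homo-+ m n = ℚ.toℚᵘ-injective (begin-equality
  ℚ.toℚᵘ ((m ℤ.+ n) ℚ./ 1)                    ≃⟨ ℚ.toℚᵘ-fromℚᵘ (mkℚᵘ (m ℤ.+ n) 0) ⟩
  mkℚᵘ (m ℤ.+ n) 0                            ≡⟨ ≡.cong₂ (λ a b → mkℚᵘ (a ℤ.+ b) 0) (ℤ.*-identityʳ m) (ℤ.*-identityʳ n) ⟨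
  mkℚᵘ m 0 ℚᵘ.+ mkℚᵘ n 0                      ≃⟨ ℚᵘ.+-cong (ℚ.toℚᵘ-fromℚᵘ (mkℚᵘ m 0)) (ℚ.toℚᵘ-fromℚᵘ (mkℚᵘ n 0)) ⟨
  ℚ.toℚᵘ (m ℚ./ 1) ℚᵘ.+ ℚ.toℚᵘ (n ℚ./ 1)      ≃⟨ ℚ.toℚᵘ-homo-+ (m ℚ./ 1) (n ℚ./ 1) ⟨
  ℚ.toℚᵘ (m ℚ./ 1 ℚ.+ n ℚ./ 1)                ∎)
  where open ℚᵘ.≤-Reasoning

/1-homo-* : ∀ m n → (m ℤ.* n) ℚ./ 1 ≡ m ℚ./ 1 ℚ.* (n ℚ./ 1)
/1-homo-* m n = ℚ.toℚᵘ-injective (begin-equality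
  ℚ.toℚᵘ ((m ℤ.* n) ℚ./ 1)                    ≃⟨ ℚ.toℚᵘ-fromℚᵘ (mkℚᵘ (m ℤ.* n) 0) ⟩
  mkℚᵘ m 0 ℚᵘ.* mkℚᵘ n 0                      ≃⟨ ℚᵘ.*-cong (ℚ.toℚᵘ-fromℚᵘ (mkℚᵘ m 0)) (ℚ.toℚᵘ-fromℚᵘ (mkℚᵘ n 0)) ⟨
  ℚ.toℚᵘ (m ℚ./ 1) ℚᵘ.* ℚ.toℚᵘ (n ℚ./ 1)      ≃⟨ ℚ.toℚᵘ-homo-* (m ℚ./ 1) (n ℚ./ 1) ⟨
  ℚ.toℚᵘ (m ℚ./ 1 ℚ.* (n ℚ./ 1))              ∎)
  where open ℚᵘ.≤-Reasoning

/1-homo-neg : ∀ m → (- m) ℚ./ 1 ≡ ℚ.- (m ℚ./ 1)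
/1-homo-neg m = ℚ.toℚᵘ-injective (begin-equality
  ℚ.toℚᵘ ((- m) ℚ./ 1)        ≃⟨ ℚ.toℚᵘ-fromℚᵘ (mkℚᵘ (- m) 0) ⟩
  ℚᵘ.- mkℚᵘ m 0               ≃⟨ ℚᵘ.-‿cong (ℚ.toℚᵘ-fromℚᵘ (mkℚᵘ m 0)) ⟨
  ℚᵘ.- ℚ.toℚᵘ (m ℚ./ 1)       ≃⟨ ℚ.toℚᵘ-homo‿- (m ℚ./ 1) ⟨
  ℚ.toℚᵘ (ℚ.- (m ℚ./ 1))      ∎)
  where open ℚᵘ.≤-Reasoning

1≤∣m/1∣ : ∀ m → m ≢ 0ℤ → 1ℚ ℚ.≤ ℚ.∣ m ℚ./ 1 ∣
1≤∣m/1∣ m m≢0 = ℚ.toℚᵘ-cancel-≤ (begin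
  mkℚᵘ 1ℤ 0                     ≤⟨ *≤* (≡.subst (1ℤ ℤ.≤_) (≡.sym (ℤ.*-identityʳ _)) (ℤ.+≤+ (nonzero m m≢0))) ⟩
  ℚᵘ.∣ mkℚᵘ m 0 ∣               ≃⟨ ℚᵘ.∣-∣-cong (ℚ.toℚᵘ-fromℚᵘ (mkℚᵘ m 0)) ⟨
  ℚᵘ.∣ ℚ.toℚᵘ (m ℚ./ 1) ∣       ≃⟨ ℚ.toℚᵘ-homo-∣-∣ (m ℚ./ 1) ⟨
  ℚ.toℚᵘ ℚ.∣ m ℚ./ 1 ∣          ∎)
  where
  open ℚᵘ.≤-Reasoning
  nonzero : ∀ m → m ≢ 0ℤ → 1 ℕ.≤ ℤ.∣ m ∣
  nonzero (+ zero)    m≢0 = contradiction ≡.refl m≢0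
  nonzero (+ suc _)   _   = s≤s z≤n
  nonzero ℤ.-[1+ _ ]  _   = s≤s z≤n

1≤∣m/1-n/1∣ : ∀ {m n} → m ≢ n → 1ℚ ℚ.≤ ℚ.∣ m ℚ./ 1 ℚ.- n ℚ./ 1 ∣
1≤∣m/1-n/1∣ {m} {n} m≢n = ≡.subst (λ p → 1ℚ ℚ.≤ ℚ.∣ p ∣)
  (≡.trans (/1-homo-+ m (- n)) (≡.cong (m ℚ./ 1 ℚ.+_) (/1-homo-neg n)))
  (1≤∣m/1∣ (m ℤ.- n) (λ m-n≡0 → m≢n (ℤ.i-j≡0⇒i≡j m n m-n≡0)))

fromℤ-morphism : ℤ.+-*-rawRing -Raw-AlmostCommutative⟶ fromCommutativeRing ℂ-commutativeRing
fromℤ-morphism = record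
  { ⟦_⟧    = fromℤ
  ; +-homo = λ m n → ≗⇒≈ℂ {fromℤ (m ℤ.+ n)} {fromℤ m +ℂ fromℤ n} (λ _ → /1-homo-+ m n) (λ _ → ≡.refl)
  ; *-homo = λ m n → ≗⇒≈ℂ {fromℤ (m ℤ.* n)} {fromℤ m *ℂ fromℤ n}
      (λ _ → ≡.trans (/1-homo-* m n)
        (solve 2 (λ p q → p :* q := p :* q :- con 0ℚ :* con 0ℚ) ≡.refl (m ℚ./ 1) (n ℚ./ 1)))
      (λ _ → solve 2 (λ p q → con 0ℚ := p :* con 0ℚ :+ con 0ℚ :* q) ≡.refl (m ℚ./ 1) (n ℚ./ 1))
  ; -‿homo = λ m → ≗⇒≈ℂ {fromℤ (- m)} { -ℂ fromℤ m} (λ _ → /1-homo-neg m) (λ _ → ≡.refl)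
  ; 0-homo = ≈ℂ-refl {0ℂ}
  ; 1-homo = ≈ℂ-refl {1ℂ}
  }

-- Distinct integers differ by at least 1, so a sequence eventually within ½ of one stays more than
-- ½ away from the other.
near-integer⇒# : ∀ {x m n} → m ≢ n → Near ½ x (fromℚ (m ℚ./ 1)) → x #ℝ fromℚ (n ℚ./ 1)
near-integer⇒# {x} {m} {n} m≢n (N , close) = ½ , ℚ.positive⁻¹ ½ , N , λ k N≤k →
  ℚ.≰⇒> (λ near → ℚ.<-irrefl ≡.refl (ℚ.<-≤-trans (begin-strict
    ℚ.∣ p ℚ.- q ∣                                     ≡⟨ ≡.cong ℚ.∣_∣ (solve 3 (λ p q x → p :- q := (p :- x) :+ (x :- q)) ≡.refl p q (seq x k)) ⟩
    ℚ.∣ (p ℚ.- seq x k) ℚ.+ (seq x k ℚ.- q) ∣         ≤⟨ ℚ.∣p+q∣≤∣p∣+∣q∣ (p ℚ.- seq x k) (seq x k ℚ.- q) ⟩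
    ℚ.∣ p ℚ.- seq x k ∣ ℚ.+ ℚ.∣ seq x k ℚ.- q ∣       ≡⟨ ≡.cong (ℚ._+ ℚ.∣ seq x k ℚ.- q ∣) (∣p-q∣≡∣q-p∣ p (seq x k)) ⟩
    ℚ.∣ seq x k ℚ.- p ∣ ℚ.+ ℚ.∣ seq x k ℚ.- q ∣       <⟨ ℚ.+-mono-<-≤ (close k N≤k) near ⟩
    ½ ℚ.+ ½                                           ≡⟨⟩
    1ℚ                                                ∎) (1≤∣m/1-n/1∣ m≢n)))
  where
  open ℚ.≤-Reasoning
  p = m ℚ./ 1
  q = n ℚ./ 1

¬#⇒≈ℂ : ∀ {z w} → ¬ (z #ℂ w) → z ≈ℂ w
¬#⇒≈ℂ {z} {w} ¬z#w = ¬#⇒≈ℝ {re z} {re w} (λ re# → ¬z#w (inj₁ re#)) , ¬#⇒≈ℝ {im z} {im w} (λ im# → ¬z#w (inj₂ im#))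

#⇒≉ℂ : ∀ {z w} → z #ℂ w → ¬ (z ≈ℂ w)
#⇒≉ℂ {z} {w} (inj₁ re#) (re≈ , _) = #⇒≉ℝ {re z} {re w} re# re≈
#⇒≉ℂ {z} {w} (inj₂ im#) (_ , im≈) = #⇒≉ℝ {im z} {im w} im# im≈

-- u w ≈ 0 is multiplied by the conjugate of u.
regularℂ : ∀ {u} → u #ℂ 0ℂ → ∀ w → u *ℂ w ≈ℂ 0ℂ → w ≈ℂ 0ℂ
regularℂ {a +i b} u#0 (c +i d) (re≈0 , im≈0) =
  regularℝ {∣u∣²} {c} ∣u∣²#0 (≈ℝ-trans {∣u∣² *ℝ c} {a *ℝ e +ℝ b *ℝ f} {0ℝ}
    (≗⇒≈ℝ {∣u∣² *ℝ c} {a *ℝ e +ℝ b *ℝ f} (λ n → solve 4 (λ a b c d →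
      (a :* a :+ b :* b) :* c := a :* (a :* c :- b :* d) :+ b :* (a :* d :+ b :* c)) ≡.refl
      (seq a n) (seq b n) (seq c n) (seq d n)))
    (combination a b e f re≈0 im≈0)) ,
  regularℝ {∣u∣²} {d} ∣u∣²#0 (≈ℝ-trans {∣u∣² *ℝ d} {a *ℝ f +ℝ (-ℝ b) *ℝ e} {0ℝ}
    (≗⇒≈ℝ {∣u∣² *ℝ d} {a *ℝ f +ℝ (-ℝ b) *ℝ e} (λ n → solve 4 (λ a b c d →
      (a :* a :+ b :* b) :* d := a :* (a :* d :+ b :* c) :+ (:- b) :* (a :* c :- b :* d)) ≡.refl
      (seq a n) (seq b n) (seq c n) (seq d n)))
    (combination a (-ℝ b) f e im≈0 re≈0))
  where
  e f ∣u∣² : ℝ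
  e = a *ℝ c -ℝ b *ℝ d
  f = a *ℝ d +ℝ b *ℝ c
  ∣u∣² = a *ℝ a +ℝ b *ℝ b
  ∣u∣²#0 : ∣u∣² #ℝ 0ℝ
  ∣u∣²#0 =
    [ sumOfSquares-#0 {a} b
    , (λ b#0 → map₂ (map₂ (map₂ (λ apart n N≤n →
        ≡.subst (λ p → _ ℚ.< ℚ.∣ p ℚ.- 0ℚ ∣) (ℚ.+-comm (seq b n ℚ.* seq b n) (seq a n ℚ.* seq a n)) (apart n N≤n))))
        (sumOfSquares-#0 {b} a b#0))
    ]′ u#0
  combination : ∀ p q x y → x ≈ℝ 0ℝ → y ≈ℝ 0ℝ → p *ℝ x +ℝ q *ℝ y ≈ℝ 0ℝ
  combination p q x y x≈0 y≈0 = ≈ℝ-trans {p *ℝ x +ℝ q *ℝ y} {p *ℝ 0ℝ +ℝ q *ℝ 0ℝ} {0ℝ}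
    (+ℝ-cong {p *ℝ x} {p *ℝ 0ℝ} {q *ℝ y} {q *ℝ 0ℝ}
      (*ℝ-cong {p} {p} {x} {0ℝ} (≈ℝ-refl {p}) x≈0) (*ℝ-cong {q} {q} {y} {0ℝ} (≈ℝ-refl {q}) y≈0))
    (≗⇒≈ℝ {p *ℝ 0ℝ +ℝ q *ℝ 0ℝ} {0ℝ} (λ n →
      solve 2 (λ p q → p :* con 0ℚ :+ q :* con 0ℚ := con 0ℚ) ≡.refl (seq p n) (seq q n)))

#⇒-#0ℂ : ∀ {z w} → z #ℂ w → (z +ℂ -ℂ w) #ℂ 0ℂ
#⇒-#0ℂ {z} {w} = Sum.map (#⇒-#0 {re z} {re w}) (#⇒-#0 {im z} {im w})

-- Testing the real part is enough: it singles out a candidate integer, and the imaginary part is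
-- settled later by tightness.
near-integer⊎apart : ∀ z m → Near ½ (re z) (fromℚ (m ℚ./ 1)) ⊎ z #ℂ fromℤ m
near-integer⊎apart z m = Sum.map₂ inj₁ (near⊎apart (re z) (fromℚ (m ℚ./ 1)) ½ (ℚ.positive⁻¹ ½))

-- The distance spectrum

allApart⊎someNear : ∀ z (ms : List ℤ) → (∀ {m} → m ∈ ms → z #ℂ fromℤ m) ⊎
  ∃[ m ] m ∈ ms × Near ½ (re z) (fromℚ (m ℚ./ 1))
allApart⊎someNear z []       = inj₁ λ ()
allApart⊎someNear z (m ∷ ms) = combine (near-integer⊎apart z m) (allApart⊎someNear z ms)
  where
  combine : Near ½ (re z) (fromℚ (m ℚ./ 1)) ⊎ z #ℂ fromℤ m →
    (∀ {m} → m ∈ ms → z #ℂ fromℤ m) ⊎ (∃[ m ] m ∈ ms × Near ½ (re z) (fromℚ (m ℚ./ 1))) →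
    (∀ {m′} → m′ ∈ m ∷ ms → z #ℂ fromℤ m′) ⊎
      ∃[ m′ ] m′ ∈ m ∷ ms × Near ½ (re z) (fromℚ (m′ ℚ./ 1))
  combine (inj₁ near) _                        = inj₂ (m , here ≡.refl , near)
  combine (inj₂ _)    (inj₂ (m′ , m′∈ , near)) = inj₂ (m′ , there m′∈ , near)
  combine (inj₂ z#m)  (inj₁ z#ms)              = inj₁ λ { (here ≡.refl) → z#m ; (there m∈) → z#ms m∈ }

-- If z is near m, it is apart from every other integer. Apartness from m as well would then mean
-- apartness from the whole list, so z is not apart from m, and tightness gives equality.
¬allApart⇒≈ : ∀ {z ms} → ¬ (∀ {m} → m ∈ ms → z #ℂ fromℤ m) → ∃[ m ] m ∈ ms × z ≈ℂ fromℤ m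
¬allApart⇒≈ {z} {ms} ¬apart =
  [ (λ apart → contradiction (λ {m} → apart {m}) ¬apart) , fromNear ]′ (allApart⊎someNear z ms)
  where
  fromNear : (∃[ m ] m ∈ ms × Near ½ (re z) (fromℚ (m ℚ./ 1))) → ∃[ m ] m ∈ ms × z ≈ℂ fromℤ m
  fromNear (m , m∈ , near) = m , m∈ ,
    ¬#⇒≈ℂ {z} {fromℤ m} λ z#m → ¬apart λ {m′} _ → apartFrom z#m m′ (m ℤ.≟ m′)
    where
    apartFrom : z #ℂ fromℤ m → ∀ m′ → Dec (m ≡ m′) → z #ℂ fromℤ m′
    apartFrom z#m _ (yes ≡.refl) = z#m
    apartFrom _ m′  (no m≢m′)    = inj₁ (near-integer⇒# {re z} {m} {m′} m≢m′ near)

2#0 : fromℤ (+ 2) #ℂ 0ℂ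
2#0 = inj₁ (near-integer⇒# {fromℚ (+ 2 ℚ./ 1)} {+ 2} {+ 0} (λ ()) (≈ℝ-refl {fromℚ (+ 2 ℚ./ 1)} ½ (ℚ.positive⁻¹ ½)))

module ℂ-Spectrum = Spectrum ℂ-commutativeRing fromℤ-morphism

module DistanceSpectrum {n k} (3<n : 3 < n) (G : Graph k) (pairs : OffDiagonal n k)
  (adjacent⁺ : ∀ {a b} → a ≢ b → OffDiagonal.Aligned pairs a b → Adj G a b)
  (adjacent⁻ : ∀ {a b} → Adj G a b → OffDiagonal.Aligned pairs a b)
  where

  open OffDiagonal pairs

  open Distance (ℕ.<⇒≤ 3<n) G pairs adjacent⁺ adjacent⁻

  connected : Connected G
  connected a b = let d , (walk , _) , _ = distance a b in d , walk

  distanceMatrix-≈ : ∀ {D : Matrix ℕ _} → IsDistanceMatrix G D →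
    ∀ a b → fromℤ (+ D a b) ≈ℂ fromℤ (distanceℤ a b)
  distanceMatrix-≈ {D} isD a b = ≡.subst (fromℤ (+ D a b) ≈ℂ_) (≡.cong fromℤ (distanceMatrix-unique isD a b)) (≈ℂ-refl {fromℤ (+ D a b)})

  regular-apart : ∀ {z m} → z #ℂ fromℤ m → ℂ-Spectrum.Regular (z +ℂ -ℂ fromℤ m)
  regular-apart {z} {m} z#m = regularℂ {z +ℂ -ℂ fromℤ m} (#⇒-#0ℂ {z} {fromℤ m} z#m)

  eigenarray-apart-trivial : ∀ {z} {w : ℂ-Spectrum.Array n} → (∀ {m} → m ∈ spectrum n → z #ℂ fromℤ m) →
    ℂ-Spectrum.Eigenarray z w → ∀ i j → w i j ≈ℂ 0ℂ
  eigenarray-apart-trivial {z} {w} apart = ℂ-Spectrum.eigenarray-trivial {n} {z} {w}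
    (regularℂ {fromℤ (+ 2)} 2#0) (λ {m} m∈ → regular-apart {z} {m} (apart m∈))

  eigenvector⇒eigenarray : ∀ {D : Matrix ℕ _} → IsDistanceMatrix G D → ∀ z v →
    (∀ a → sumℂ (λ b → fromℤ (+ D a b) *ℂ v b) ≈ℂ z *ℂ v a) → ℂ-Spectrum.Eigenarray z (ℂ-Spectrum.fill pairs v)
  eigenvector⇒eigenarray {D} isD z v eigen =
    ℂ-Spectrum.eigenvector⇒eigenarray pairs {λ a b → fromℤ (+ D a b)} (distanceMatrix-≈ isD) {z} v eigen

  fill-≈0 : ∀ v → (∀ i j → ℂ-Spectrum.fill pairs v i j ≈ℂ 0ℂ) → ∀ a → v a ≈ℂ 0ℂ
  fill-≈0 v fill≈0 a = ≡.subst (_≈ℂ 0ℂ) (ℂ-Spectrum.fill-pair pairs v a) (fill≈0 (row a) (col a))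

  eigenvalue⇒spectrum : ∀ z → IsDistanceEigenvalue G z →
    ∃[ m ] m ∈ spectrum n × z ≈ℂ fromℤ m
  eigenvalue⇒spectrum z (D , isD , v , (a , va#0) , eigen) = ¬allApart⇒≈ {z} λ apart →
    #⇒≉ℂ {v a} {0ℂ} va#0 (fill-≈0 v
      (eigenarray-apart-trivial {z} {ℂ-Spectrum.fill pairs v} apart (eigenvector⇒eigenarray isD z v eigen)) a)

  arrayEigenvalue⇒eigenvalue : ∀ {D} → IsDistanceMatrix G D → ∀ {z} → ℂ-Spectrum.IsArrayEigenvalue n z →
    IsDistanceEigenvalue G z
  arrayEigenvalue⇒eigenvalue {D} isD {z} (w , eigenarray , i , j , i≢j , wij≈1) =
    D , isD , (λ a → w (row a) (col a)) , nonzero (ℂ-Spectrum.pair-≈ pairs w {x = 1ℂ} i≢j wij≈1) ,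
    ℂ-Spectrum.eigenarray⇒eigenvector pairs {λ a b → fromℤ (+ D a b)} (distanceMatrix-≈ isD) {z} {w} eigenarray
    where
    nonzero : ∃[ a ] w (row a) (col a) ≈ℂ 1ℂ → ∃[ a ] w (row a) (col a) #ℂ 0ℂ
    -- An entry equal to 1 is within ½ of the integer 1, hence apart from the integer 0.
    nonzero (a , w≈1) = a , inj₁ (near-integer⇒# {re (w (row a) (col a))} {+ 1} {+ 0} (λ ())
      (proj₁ w≈1 ½ (ℚ.positive⁻¹ ½)))

  spectrum⇒eigenvalue : ∀ {z m} → m ∈ spectrum n → z ≈ℂ fromℤ m → IsDistanceEigenvalue G z
  spectrum⇒eigenvalue {z} {m} m∈ z≈m = arrayEigenvalue⇒eigenvalue
    (λ a b → proj₁ (proj₂ (distance a b))) {z}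
    (ℂ-Spectrum.isArrayEigenvalue-resp-≈ {n} {fromℤ m} {z} (≈ℂ-sym {z} {fromℤ m} z≈m) (ℂ-Spectrum.spectrum⇒eigenvalue 3<n m∈))

open import Data.Integer.Base using (_+_; _-_; _*_)

theorem2p8 : (n : ℕ) → 3 < n →
    DistanceIntegral (lineGraph (crown n)) ×
    (∀ (z : ℂ) → IsDistanceEigenvalue (lineGraph (crown n)) z ⇔
    (∃[ m ] (m ∈ (- + n - + 1) ∷ (- + n + + 3) ∷ -1ℤ ∷ 1ℤ ∷ (+ 2 * (+ n * + n) - + 4 * + n + + 3) ∷ []
    × z ≈ℂ fromℤ m)))
theorem2p8 n 3<n =
  (connected , λ z isEigenvalue → let m , _ , z≈m = eigenvalue⇒spectrum z isEigenvalue in m , z≈m) ,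
  λ z → mk⇔ (eigenvalue⇒spectrum z)
            (λ (m , m∈ , z≈m) → spectrum⇒eigenvalue {z} {m} m∈ z≈m)
  where
  open CrownLineGraph n
  open DistanceSpectrum 3<n (lineGraph (crown n)) pairs adjacent⁺ adjacent⁻
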